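{- Let $\boldsymbol{\Upsilon}_{\mathbf{HGP}}:\mathbf{HGP}\to\mathbf{WQSym}$ be the linear map sending a hypergraphic polytope $\mathfrak{q}\subseteq\mathbb{R}^n$ to $\boldsymbol{\Upsilon}_{\mathbf{HGP}}(\mathfrak{q})=\sum_f\mathbf{a}_{f(1)}\cdots\mathbf{a}_{f(n)}$, the sum running over all $\mathfrak{q}$-generic functions $f:[n]\to\mathbb{N}$. Then the linear space $\ker\boldsymbol{\Upsilon}_{\mathbf{HGP}}$ is generated (spanned) by the simple relations and the modular relations on hypergraphic polytopes. The image of $\boldsymbol{\Upsilon}_{\mathbf{HGP}}$ is $\mathbf{SC}$, which is a proper subspace of $\mathbf{WQSym}$.
   Context: $\mathbb{K}$ is a field of characteristic zero; $\mathbb{N}=\{1,2,\dots\}$, $[n]=\{1,\dots,n\}$; $\{\mathbf{a}_i\}_{i\ge1}$ are non-commuting variables. Polytopes. For non-empty $J\subseteq[n]$ let $\mathfrak{s}_J=\mathrm{conv}\{e_j : j\in J\}\subseteq\mathbb{R}^n$. A hypergraphic polytope in $\mathbb{R}^n$ is a Minkowski sum $\mathfrak{q}=\sum_{\emptyset\ne J\subseteq[n]}a_J\mathfrak{s}_J$ with real $a_J\ge0$ (the empty sum is $\{0\}$). The $a_J$ are determined by $\mathfrak{q}$, and $\mathcal{F}(\mathfrak{q})=\{J : a_J>0\}$. For a family $\mathcal{A}$ of non-empty subsets of $[n]$, $\mathcal{F}^{ -1}(\mathcal{A})=\sum_{J\in\mathcal{A}}\mathfrak{s}_J$. $\mathbf{HGP}=\bigoplus_{n\ge0}\mathbf{HGP}_n$,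 with $\mathbf{HGP}_n$ the $\mathbb{K}$-vector space freely generated by the hypergraphic polytopes in $\mathbb{R}^n$. A function $f:[n]\to\mathbb{N}$ is $\mathfrak{q}$-generic if the face of $\mathfrak{q}$ on which $x\mapsto\sum_i f(i)x_i$ is minimized is a point. Set compositions. $\mathbf{C}_n$ is the set of set compositions $\vec{\boldsymbol{\pi}}=S_1|\cdots|S_k$ of $[n]$ (ordered lists of non-empty disjoint sets with union $[n]$). For non-empty $A\subseteq[n]$, $A_{\vec{\boldsymbol{\pi}}}=A\cap S_i$ with $i$ the smallest index such that $A\cap S_i\neq\emptyset$. For $f:[n]\to\mathbb{N}$, $\vec{\boldsymbol{\pi}}(f)$ is obtained from $f^{ -1}(1)|f^{ -1}(2)|\cdots$ by deleting empty sets. $\mathbf{M}_{\vec{\boldsymbol{\pi}}}=\sum_{f:\,\vec{\boldsymbol{\pi}}(f)=\vec{\boldsymbol{\pi}}}\mathbf{a}_{f(1)}\cdots\mathbf{a}_{f(n)}$; $\mathbf{WQSym}_n$ is the $\mathbb{K}$-span of $\{\mathbf{M}_{\vec{\boldsymbol{\pi}}}\}_{\vec{\boldsymbol{\pi}}\in\mathbf{C}_n}$ and $\mathbf{WQSym}=\bigoplus_{n\ge 0}\mathbf{WQSym}_n$. The space $\mathbf{SC}$. On $\mathbf{C}_n$ set $\vec{\boldsymbol{\pi}}\sim\vec{\boldsymbol{\tau}}$ if for every non-empty $A\subseteq[n]$: $\#A_{\vec{\boldsymbol{\pi}}}=1\Leftrightarrow\#A_{\vec{\boldsymbol{\tau}}}=1$.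 Let $\mathbf{N}_{[\vec{\boldsymbol{\pi}}]}=\sum_{\vec{\boldsymbol{\tau}}\sim\vec{\boldsymbol{\pi}}}\mathbf{M}_{\vec{\boldsymbol{\tau}}}$. $\mathbf{SC}$ is the span of all $\mathbf{N}_{[\vec{\boldsymbol{\pi}}]}$, $[\vec{\boldsymbol{\pi}}]\in\mathbf{C}_n/\!\sim$, $n\ge0$. Relations. A simple relation is $\mathfrak{q}_1-\mathfrak{q}_2\in\mathbf{HGP}$ (formal difference) with $\mathfrak{q}_1,\mathfrak{q}_2$ hypergraphic polytopes in the same $\mathbb{R}^n$ and $\mathcal{F}(\mathfrak{q}_1)=\mathcal{F}(\mathfrak{q}_2)$. For non-empty $A\subseteq[n]$ let $\mathrm{Orth}\,A=\{\vec{\boldsymbol{\pi}}\in\mathbf{C}_n : \#A_{\vec{\boldsymbol{\pi}}}=1\}$. Given disjoint families $\mathcal{A},\mathcal{B}$ of non-empty subsets of $[n]$ with $\bigcup_{A\in\mathcal{A}}(\mathrm{Orth}\,A)^c\cup\bigcup_{B\in\mathcal{B}}\mathrm{Orth}\,B=\mathbf{C}_n$, the corresponding modular relation is the formal linear combination $\sum_{\mathcal{T}\subseteq\mathcal{B}}(-1)^{\#\mathcal{T}}\big[\mathcal{F}^{ -1}(\mathcal{A})+\mathcal{F}^{ -1}(\mathcal{T})\big]\in\mathbf{HGP}_n$, where the sum inside the brackets is a Minkowski sum. -}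

module Defs where

open import Level using (Level; _⊔_) renaming (suc to lsuc)
open import Algebra.Apartness.Bundles using (HeytingField; HeytingCommutativeRing)
open import Algebra.Bundles using (Ring; CommutativeRing)
open import Algebra.Module.Bundles using (LeftModule)
open import Algebra.Module.Morphism.Structures using (module LeftModuleMorphisms)
import Algebra.Properties.CommutativeMonoid.Sum as Summation
import Algebra.Properties.Monoid.Mult as Multiple
import Algebra.Properties.Semiring.Exp as Exponentiation
open import Data.Bool.Base using (if_then_else_)
import Data.Bool.Properties as Bool
open import Data.Fin.Base using (Fin)
import Data.Fin.Properties as Fin
open import Data.Fin.Subset as Subset
  using (Subset; ⊤; ⊥; _∩_; ⋃; Nonempty; ∣_∣)
open import Data.Fin.Subset.Properties using (nonempty?; anySubset?)
open import Data.List.Base as List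
  using (List; []; _∷_; _++_; length; upTo; concatMap; mapMaybe; cartesianProductWith)
import Data.List.Membership.Propositional as List
import Data.List.Properties as List
open import Data.List.Relation.Binary.Disjoint.Propositional using (Disjoint)
open import Data.List.Relation.Unary.All using (All; all?)
open import Data.List.Relation.Unary.AllPairs using (AllPairs; allPairs?)
open import Data.List.Relation.Unary.Any using (Any)
open import Data.List.Relation.Unary.Unique.Propositional using (Unique)
import Data.Maybe.Base as Maybe
open import Data.Nat.Base as ℕ using (ℕ; zero; suc)
import Data.Nat.Properties as ℕ
open import Data.Product.Base using (∃; ∃₂; Σ; _×_; _,_)
open import Data.Sum.Base using (_⊎_)
open import Data.Vec.Base as Vec using (Vec; []; _∷_; lookup)
import Data.Vec.Properties as Vec
open import Data.Vec.Functional using (Vector)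
open import Function.Base using (_∘_; id)
open import Function.Bundles using (_⇔_; mk⇔; Equivalence)
open import Relation.Binary.Bundles using (Setoid)
open import Relation.Binary.Core using (Rel)
open import Relation.Binary.Construct.StrictToNonStrict using (_≤_)
open import Relation.Binary.Definitions using (Decidable; DecidableEquality)
open import Relation.Binary.PropositionalEquality.Core using (_≡_; _≢_; refl)
open import Relation.Binary.Structures using (IsStrictTotalOrder)
open import Relation.Nullary.Decidable.Core
  using (Dec; yes; no; does; dec⇒maybe; map′; decidable-stable; ¬?; _×-dec_; _→-dec_)
open import Relation.Nullary.Negation.Core using (¬_)
open import Relation.Unary using (Pred; _∈_; _∉_; _≐_; Satisfiable)
import Relation.Unary as Unary

private
  variable
    n : ℕ

fieldCommutativeRing : ∀ {c ℓ₁ ℓ₂} → HeytingField c ℓ₁ ℓ₂ → CommutativeRing c ℓ₁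
fieldCommutativeRing K =
  HeytingCommutativeRing.commutativeRing (HeytingField.heytingCommutativeRing K)

fieldRing : ∀ {c ℓ₁ ℓ₂} → HeytingField c ℓ₁ ℓ₂ → Ring c ℓ₁
fieldRing K = CommutativeRing.ring (fieldCommutativeRing K)

CharacteristicZero : ∀ {c ℓ₁ ℓ₂} → HeytingField c ℓ₁ ℓ₂ → Set ℓ₁
CharacteristicZero K = ∀ m → ¬ (suc m · 1# ≈ 0#)
  where
  open CommutativeRing (fieldCommutativeRing K)
  open Multiple +-monoid renaming (_×_ to _·_)

-- The real numbers, axiomatised as a Dedekind-complete ordered field.
-- As in classical mathematics the order is trichotomous, and hence
-- decidable.

record RealNumbers (r : Level) : Set (lsuc r) where
  field
    heytingField : HeytingField r r r

  open CommutativeRing (fieldCommutativeRing heytingField) public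
  open HeytingField heytingField public using (_#_)

  field
    _<_                : Rel Carrier r
    isStrictTotalOrder : IsStrictTotalOrder _≈_ _<_
    <⇒#                : ∀ {x y} → x < y → x # y
    +-monoʳ-<          : ∀ x {y z} → y < z → (x + y) < (x + z)
    *-pos              : ∀ {x y} → 0# < x → 0# < y → 0# < (x * y)

  infix 4 _<_ _≤ᴿ_

  _≤ᴿ_ : Rel Carrier r
  _≤ᴿ_ = _≤_ _≈_ _<_

  IsUpperBound : Pred Carrier r → Pred Carrier r
  IsUpperBound S b = ∀ x → x ∈ S → x ≤ᴿ b

  field
    supremum : ∀ (S : Pred Carrier r) → Satisfiable S → Satisfiable (IsUpperBound S) →
               ∃ λ s → s ∈ IsUpperBound S × (∀ b → b ∈ IsUpperBound S → s ≤ᴿ b)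

module _ {c ℓ m ℓm} {R : Ring c ℓ} (V : LeftModule R m ℓm) where

  open LeftModule V

  data Span {g} (G : Pred Carrierᴹ g) : Pred Carrierᴹ (c ⊔ m ⊔ ℓm ⊔ g) where
    gen   : ∀ {x} → x ∈ G → x ∈ Span G
    zero  : 0ᴹ ∈ Span G
    add   : ∀ {x y} → x ∈ Span G → y ∈ Span G → (x +ᴹ y) ∈ Span G
    scale : ∀ a {x} → x ∈ Span G → (a *ₗ x) ∈ Span G
    resp  : ∀ {x y} → x ≈ᴹ y → x ∈ Span G → y ∈ Span G

  ∑ᴹ : ∀ {a} {A : Set a} → List A → (A → Carrierᴹ) → Carrierᴹ
  ∑ᴹ xs f = List.foldr _+ᴹ_ 0ᴹ (List.map f xs)

module FreeModule {c ℓ b ℓb} (R : Ring c ℓ) (B : Setoid b ℓb) where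

  open Ring R
  private module B = Setoid B

  infixl 6 _+ᶠ_
  infixr 7 _*ᶠ_
  infix  4 _≈ᶠ_

  data Free : Set (c ⊔ b) where
    0ᶠ   : Free
    _+ᶠ_ : Free → Free → Free
    _*ᶠ_ : Carrier → Free → Free
    [_]  : B.Carrier → Free

  data _≈ᶠ_ : Rel Free (c ⊔ ℓ ⊔ b ⊔ ℓb) where
    ≈refl       : ∀ {x} → x ≈ᶠ x
    ≈sym        : ∀ {x y} → x ≈ᶠ y → y ≈ᶠ x
    ≈trans      : ∀ {x y z} → x ≈ᶠ y → y ≈ᶠ z → x ≈ᶠ z
    []-cong     : ∀ {p q} → p B.≈ q → [ p ] ≈ᶠ [ q ]
    +ᶠ-cong     : ∀ {x x′ y y′} → x ≈ᶠ x′ → y ≈ᶠ y′ → x +ᶠ y ≈ᶠ x′ +ᶠ y′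
    *ᶠ-cong     : ∀ {a a′ x x′} → a ≈ a′ → x ≈ᶠ x′ → a *ᶠ x ≈ᶠ a′ *ᶠ x′
    +ᶠ-assoc    : ∀ x y z → (x +ᶠ y) +ᶠ z ≈ᶠ x +ᶠ (y +ᶠ z)
    +ᶠ-comm     : ∀ x y → x +ᶠ y ≈ᶠ y +ᶠ x
    +ᶠ-identˡ   : ∀ x → 0ᶠ +ᶠ x ≈ᶠ x
    *ᶠ-zeroˡ    : ∀ x → 0# *ᶠ x ≈ᶠ 0ᶠ
    *ᶠ-identˡ   : ∀ x → 1# *ᶠ x ≈ᶠ x
    *ᶠ-assoc    : ∀ a a′ x → (a * a′) *ᶠ x ≈ᶠ a *ᶠ (a′ *ᶠ x)
    *ᶠ-distribˡ : ∀ a x y → a *ᶠ (x +ᶠ y) ≈ᶠ a *ᶠ x +ᶠ a *ᶠ y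
    *ᶠ-distribʳ : ∀ x a a′ → (a + a′) *ᶠ x ≈ᶠ a *ᶠ x +ᶠ a′ *ᶠ x

  -ᶠ_ : Free → Free
  -ᶠ x = (- 1#) *ᶠ x

  private
    *ᶠ-zeroʳ : ∀ a → a *ᶠ 0ᶠ ≈ᶠ 0ᶠ
    *ᶠ-zeroʳ a = ≈trans (*ᶠ-cong (Ring.refl R) (≈sym (*ᶠ-zeroˡ 0ᶠ)))
                (≈trans (≈sym (*ᶠ-assoc a 0# 0ᶠ))
                (≈trans (*ᶠ-cong (zeroʳ a) ≈refl) (*ᶠ-zeroˡ 0ᶠ)))

    inverseʳ : ∀ x → x +ᶠ (-ᶠ x) ≈ᶠ 0ᶠ
    inverseʳ x = ≈trans (+ᶠ-cong (≈sym (*ᶠ-identˡ x)) ≈refl)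
                (≈trans (≈sym (*ᶠ-distribʳ x 1# (- 1#)))
                (≈trans (*ᶠ-cong (-‿inverseʳ 1#) ≈refl) (*ᶠ-zeroˡ x)))

  freeModule : LeftModule R (c ⊔ b) (c ⊔ ℓ ⊔ b ⊔ ℓb)
  freeModule = record
    { Carrierᴹ = Free ; _≈ᴹ_ = _≈ᶠ_ ; _+ᴹ_ = _+ᶠ_ ; _*ₗ_ = _*ᶠ_ ; 0ᴹ = 0ᶠ ; -ᴹ_ = -ᶠ_
    ; isLeftModule = record
      { isLeftSemimodule = record
        { +ᴹ-isCommutativeMonoid = record
          { isMonoid = record
            { isSemigroup = record
              { isMagma = record
                { isEquivalence = record { refl = ≈refl ; sym = ≈sym ; trans = ≈trans }
                ; ∙-cong        = +ᶠ-cong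
                }
              ; assoc = +ᶠ-assoc
              }
            ; identity = +ᶠ-identˡ , λ x → ≈trans (+ᶠ-comm x 0ᶠ) (+ᶠ-identˡ x)
            }
          ; comm = +ᶠ-comm
          }
        ; isPreleftSemimodule = record
          { *ₗ-cong      = *ᶠ-cong
          ; *ₗ-zeroˡ     = *ᶠ-zeroˡ
          ; *ₗ-distribʳ  = *ᶠ-distribʳ
          ; *ₗ-identityˡ = *ᶠ-identˡ
          ; *ₗ-assoc     = *ᶠ-assoc
          ; *ₗ-zeroʳ     = *ᶠ-zeroʳ
          ; *ₗ-distribˡ  = *ᶠ-distribˡ
          }
        }
      ; -ᴹ‿cong    = *ᶠ-cong (Ring.refl R)
      ; -ᴹ‿inverse = (λ x → ≈trans (+ᶠ-comm (-ᶠ x) x) (inverseʳ x)) , inverseʳ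
      }
    }

subsets : ∀ n → List (Subset n)
subsets zero    = [] ∷ []
subsets (suc n) = List.map (Subset.outside ∷_) (subsets n) ++ List.map (Subset.inside ∷_) (subsets n)

nonemptySubsets : ∀ n → List (Subset n)
nonemptySubsets n = List.filter nonempty? (subsets n)

-- If xs has no repetitions, then each subset of its set of entries is
-- the set of entries of exactly one member of sublists xs.

sublists : ∀ {a} {A : Set a} → List A → List (List A)
sublists []       = [] ∷ []
sublists (x ∷ xs) = sublists xs ++ List.map (x ∷_) (sublists xs)

listsOfLength : ∀ {a} {A : Set a} → ℕ → List A → List (List A)
listsOfLength zero    xs = [] ∷ []
listsOfLength (suc k) xs = cartesianProductWith _∷_ xs (listsOfLength k xs)

private
  allSubsets? : ∀ {p} {P : Pred (Subset n) p} → Unary.Decidable P → Dec (∀ A → P A)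
  allSubsets? P? = map′
    (λ ¬∃ A → decidable-stable (P? A) (λ ¬p → ¬∃ (A , ¬p)))
    (λ ∀p (A , ¬p) → ¬p (∀p A))
    (¬? (anySubset? (¬? ∘ P?)))

  _⇔-dec_ : ∀ {a b} {A : Set a} {B : Set b} → Dec A → Dec B → Dec (A ⇔ B)
  a? ⇔-dec b? = map′ (λ (f , g) → mk⇔ f g) (λ e → Equivalence.to e , Equivalence.from e)
                     ((a? →-dec b?) ×-dec (b? →-dec a?))

_≟ˢ_ : DecidableEquality (Subset n)
_≟ˢ_ = Vec.≡-dec Bool._≟_

record IsSetComposition {n} (Ss : List (Subset n)) : Set where
  field
    nonempty : All Nonempty Ss
    disjoint : AllPairs (λ S T → Subset.Empty (S ∩ T)) Ss
    covering : ⋃ Ss ≡ ⊤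

isSetComposition? : Unary.Decidable (IsSetComposition {n})
isSetComposition? Ss = map′
  (λ (ne , dj , cv) → record { nonempty = ne ; disjoint = dj ; covering = cv })
  (λ π → let open IsSetComposition π in nonempty , disjoint , covering)
  (all? nonempty? Ss ×-dec allPairs? (λ S T → ¬? (nonempty? (S ∩ T))) Ss ×-dec (⋃ Ss ≟ˢ ⊤))

record SetComposition (n : ℕ) : Set where
  constructor _since_
  field
    blocks           : List (Subset n)
    isSetComposition : IsSetComposition blocks

open SetComposition public using (blocks)

-- A set composition of [n] has at most n blocks.

setCompositions : ∀ n → List (SetComposition n)
setCompositions n =
  mapMaybe (λ Ss → Maybe.map (Ss since_) (dec⇒maybe (isSetComposition? Ss)))
           (concatMap (λ k → listsOfLength k (subsets n)) (upTo (suc n)))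

-- A ∥ π is A_π, the first non-empty intersection of A with a block of π.

infix 7 _∥_

_∥_ : Subset n → SetComposition n → Subset n
A ∥ π = firstMeet (blocks π)
  where
  firstMeet : List (Subset _) → Subset _
  firstMeet []       = ⊥
  firstMeet (S ∷ Ss) = if does (nonempty? (A ∩ S)) then A ∩ S else firstMeet Ss

Orth : Subset n → Pred (SetComposition n) _
Orth A π = ∣ A ∥ π ∣ ≡ 1

infix 4 _∼_ _∼?_

_∼_ : Rel (SetComposition n) _
π ∼ τ = ∀ A → Nonempty A → (π ∈ Orth A ⇔ τ ∈ Orth A)

_∼?_ : Decidable (_∼_ {n})
π ∼? τ = allSubsets? λ A →
  nonempty? A →-dec ((∣ A ∥ π ∣ ℕ.≟ 1) ⇔-dec (∣ A ∥ τ ∣ ℕ.≟ 1))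

-- A word w encodes the function f : [n] → {1,2,…} with f(i) = suc (lookup w i),
-- and stands for the monomial a_{f(1)} ⋯ a_{f(n)}.

Word : ℕ → Set
Word = Vec ℕ

level : Word n → ℕ → Subset n
level w k = Vec.map (λ l → does (l ℕ.≟ k)) w

-- The blocks of π(f).  Beyond the largest letter of w all levels are
-- empty.

wordBlocks : Word n → List (Subset n)
wordBlocks w = List.filter nonempty? (List.map (level w) (upTo (suc (Vec.foldr′ ℕ._⊔_ 0 w))))

module Polytopes {r} (ℝ : RealNumbers r) where

  open RealNumbers ℝ
  open Summation +-commutativeMonoid using (sum)
  open Multiple +-monoid renaming (_×_ to _·_)

  Point : ℕ → Set r
  Point n = Vector Carrier n

  infix  4 _≋_
  infixl 6 _+ₚ_ _⊕_
  infixr 7 _*ₚ_ _⊙_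

  _≋_ : Rel (Point n) r
  x ≋ y = ∀ i → x i ≈ y i

  0ₚ : Point n
  0ₚ i = 0#

  _+ₚ_ : Point n → Point n → Point n
  (x +ₚ y) i = x i + y i

  _*ₚ_ : Carrier → Point n → Point n
  (a *ₚ x) i = a * x i

  e : Fin n → Point n
  e j i = if does (j Fin.≟ i) then 1# else 0#

  PointSet : ℕ → Set (lsuc r)
  PointSet n = Pred (Point n) r

  conv : PointSet n → PointSet n
  conv X x = ∃ λ k → Σ (Vector Carrier k) λ t → Σ (Vector (Point _) k) λ p →
    (∀ i → 0# ≤ᴿ t i) × sum t ≈ 1# × (∀ i → p i ∈ X) × x ≋ (λ j → sum (λ i → t i * p i j))

  _⊙_ : Carrier → PointSet n → PointSet n
  (a ⊙ X) z = ∃ λ x → x ∈ X × z ≋ a *ₚ x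

  _⊕_ : PointSet n → PointSet n → PointSet n
  (X ⊕ Y) z = ∃₂ λ x y → x ∈ X × y ∈ Y × z ≋ x +ₚ y

  minkowskiSum : ∀ {a} {A : Set a} → List A → (A → PointSet n) → PointSet n
  minkowskiSum xs X = List.foldr _⊕_ (_≋ 0ₚ) (List.map X xs)

  simplex : Subset n → PointSet n
  simplex J = conv (λ p → ∃ λ j → j Subset.∈ J × p ≋ e j)

  record HypergraphicPolytope (n : ℕ) : Set r where
    field
      coeff   : Subset n → Carrier
      coeff≥0 : ∀ J → Nonempty J → 0# ≤ᴿ coeff J

    points : PointSet n
    points = minkowskiSum (nonemptySubsets n) (λ J → coeff J ⊙ simplex J)

  open HypergraphicPolytope public using (coeff; points)

  -- Polytopes are compared as point sets, not by their coefficients.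

  data _≅_ : Rel (∃ HypergraphicPolytope) r where
    same : {p q : HypergraphicPolytope n} → points p ≐ points q → (n , p) ≅ (n , q)

  polytopes : Setoid r r
  polytopes = record
    { Carrier       = ∃ HypergraphicPolytope
    ; _≈_           = _≅_
    ; isEquivalence = record
      { refl  = same (id , id)
      ; sym   = λ { (same (f , g)) → same (g , f) }
      ; trans = λ { (same (f , g)) (same (f′ , g′)) → same (f′ ∘ f , g ∘ g′) }
      }
    }

  -- The coefficients at non-empty subsets are determined by the point set.

  𝓕 : HypergraphicPolytope n → Pred (Subset n) r
  𝓕 q J = Nonempty J × 0# < coeff q J

  𝓕⁻¹ : List (Subset n) → PointSet n
  𝓕⁻¹ 𝒜 = minkowskiSum 𝒜 simplex

  ⟨_,_⟩ : Word n → Point n → Carrier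
  ⟨ w , x ⟩ = sum (λ i → suc (lookup w i) · x i)

  minimalFace : HypergraphicPolytope n → Word n → PointSet n
  minimalFace q w x = x ∈ points q × (∀ y → y ∈ points q → ⟨ w , x ⟩ ≤ᴿ ⟨ w , y ⟩)

  Generic : HypergraphicPolytope n → Pred (Word n) r
  Generic q w = ∃ λ x → minimalFace q w ≐ (_≋ x)

module WordSymmetric {c ℓ₁ ℓ₂} (K : HeytingField c ℓ₁ ℓ₂) where

  open CommutativeRing (fieldCommutativeRing K)

  Series : Set c
  Series = ∀ n → Word n → Carrier

  series : LeftModule ring c ℓ₁
  series = record
    { Carrierᴹ = Series
    ; _≈ᴹ_     = λ F G → ∀ n w → F n w ≈ G n w
    ; _+ᴹ_     = λ F G n w → F n w + G n w
    ; _*ₗ_     = λ a F n w → a * F n w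
    ; 0ᴹ       = λ n w → 0#
    ; -ᴹ_      = λ F n w → - F n w
    ; isLeftModule = record
      { isLeftSemimodule = record
        { +ᴹ-isCommutativeMonoid = record
          { isMonoid = record
            { isSemigroup = record
              { isMagma = record
                { isEquivalence = record
                  { refl  = λ n w → CommutativeRing.refl (fieldCommutativeRing K)
                  ; sym   = λ p n w → sym (p n w)
                  ; trans = λ p q n w → trans (p n w) (q n w)
                  }
                ; ∙-cong = λ p q n w → +-cong (p n w) (q n w)
                }
              ; assoc = λ F G H n w → +-assoc _ _ _
              }
            ; identity = (λ F n w → +-identityˡ _) , (λ F n w → +-identityʳ _)
            }
          ; comm = λ F G n w → +-comm _ _
          }
        ; isPreleftSemimodule = record
          { *ₗ-cong      = λ p q n w → *-cong p (q n w)
          ; *ₗ-zeroˡ     = λ F n w → zeroˡ _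
          ; *ₗ-distribʳ  = λ F a b n w → distribʳ _ _ _
          ; *ₗ-identityˡ = λ F n w → *-identityˡ _
          ; *ₗ-assoc     = λ a b F n w → *-assoc _ _ _
          ; *ₗ-zeroʳ     = λ a n w → zeroʳ _
          ; *ₗ-distribˡ  = λ a F G n w → distribˡ _ _ _
          }
        }
      ; -ᴹ‿cong    = λ p n w → -‿cong (p n w)
      ; -ᴹ‿inverse = (λ F n w → -‿inverseˡ _) , (λ F n w → -‿inverseʳ _)
      }
    }

  -- F is the formal sum of the monomials of the words of length n
  -- satisfying P.

  record IsMonomialSum {p} (P : Pred (Word n) p) (F : Series) : Set (p ⊔ ℓ₁) where
    field
      inside      : ∀ w → w ∈ P → F n w ≈ 1#
      outside     : ∀ w → w ∉ P → F n w ≈ 0#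
      otherDegree : ∀ m (w : Word m) → m ≢ n → F m w ≈ 0#

  M : SetComposition n → Series
  M {n} π m w with m ℕ.≟ n
  ... | yes refl = if does (List.≡-dec _≟ˢ_ (wordBlocks w) (blocks π)) then 1# else 0#
  ... | no  _    = 0#

  N : SetComposition n → Series
  N {n} π = ∑ᴹ series (List.filter (_∼? π) (setCompositions n)) M

  WQSym : Pred Series (c ⊔ ℓ₁)
  WQSym = Span series (λ F → ∃₂ λ n (π : SetComposition n) → F ≡ M π)

  SC : Pred Series (c ⊔ ℓ₁)
  SC = Span series (λ F → ∃₂ λ n (π : SetComposition n) → F ≡ N π)

module HypergraphicPolytopes
  {c ℓ₁ ℓ₂ r} (K : HeytingField c ℓ₁ ℓ₂) (ℝ : RealNumbers r) where

  open CommutativeRing (fieldCommutativeRing K) using (1#; -_; semiring)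
  open Exponentiation semiring using (_^_)
  open Polytopes ℝ
  open WordSymmetric K
  open FreeModule (fieldRing K) polytopes

  -- As a free module on the disjoint union of the bases, this is the
  -- direct sum of the graded pieces.

  HGP : LeftModule (fieldRing K) (c ⊔ r) (c ⊔ ℓ₁ ⊔ r)
  HGP = freeModule

  open LeftModule HGP using (Carrierᴹ; _+ᴹ_; -ᴹ_; _*ₗ_; rawLeftModule)

  ⟦_⟧ : HypergraphicPolytope n → Carrierᴹ
  ⟦ q ⟧ = [ _ , q ]

  data SimpleRelation : Pred Carrierᴹ (c ⊔ r) where
    simple : (q₁ q₂ : HypergraphicPolytope n) → 𝓕 q₁ ≐ 𝓕 q₂ →
             (⟦ q₁ ⟧ +ᴹ -ᴹ ⟦ q₂ ⟧) ∈ SimpleRelation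

  data ModularRelation : Pred Carrierᴹ (c ⊔ r) where
    modular :
      (𝒜 ℬ : List (Subset n)) →
      All Nonempty 𝒜 → Unique 𝒜 → All Nonempty ℬ → Unique ℬ → Disjoint 𝒜 ℬ →
      (∀ π → Any (λ A → π ∉ Orth A) 𝒜 ⊎ Any (λ B → π ∈ Orth B) ℬ) →
      (q : List (Subset n) → HypergraphicPolytope n) →
      (∀ {𝒯} → 𝒯 List.∈ sublists ℬ → points (q 𝒯) ≐ (𝓕⁻¹ 𝒜 ⊕ 𝓕⁻¹ 𝒯)) →
      (∑ᴹ HGP (sublists ℬ) λ 𝒯 → (- 1#) ^ length 𝒯 *ₗ ⟦ q 𝒯 ⟧) ∈ ModularRelation

  record IsΥ (Υ : Carrierᴹ → Series) : Set (c ⊔ ℓ₁ ⊔ r) where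
    field
      isLinear : LeftModuleMorphisms.IsLeftModuleHomomorphism
                   rawLeftModule (LeftModule.rawLeftModule series) Υ
      inWQSym  : ∀ x → Υ x ∈ WQSym
      onBasis  : (q : HypergraphicPolytope n) → IsMonomialSum (Generic q) (Υ ⟦ q ⟧)

  Kernel : (Carrierᴹ → Series) → Pred Carrierᴹ ℓ₁
  Kernel Υ x = LeftModule._≈ᴹ_ series (Υ x) (LeftModule.0ᴹ series)

  Image : (Carrierᴹ → Series) → Pred Series (c ⊔ ℓ₁ ⊔ r)
  Image Υ F = ∃ λ x → LeftModule._≈ᴹ_ series (Υ x) F

{-# OPTIONS --safe #-}
-- A word w is generic for a polytope q iff every J in 𝓕(q) has exactly one
-- letter of minimal value under w, i.e. iff the set composition of w lies in
-- Orth J for all J in 𝓕(q).  So modulo simple relations q is the family 𝓕(q),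
-- and Υ sends a family to the indicator of an intersection of sets Orth J.
--
-- Splitting [𝒜] = ([𝒜] − [𝒜 ∪ {C}]) + [𝒜 ∪ {C}] over all non-empty C expresses
-- every family by the elements Δ 𝒜 ℬ = ∑_{𝒯 ⊆ ℬ} (−1)^#𝒯 [𝒜 ∪ 𝒯] with ℬ the
-- complement of 𝒜.  If some π separates 𝒜 from ℬ, that is, lies in Orth A for
-- A in 𝒜 and in no Orth B for B in ℬ, then Υ (Δ 𝒜 ℬ) = N_[π]; otherwise Δ 𝒜 ℬ
-- is a modular relation.  The series N_[π] have disjoint non-empty supports,
-- so the coefficients of the Δ 𝒜 ℬ that are not relations can be read off Υ x
-- at one word per class.

module Submission where

open import Defs
open import Level using (Level)
open import Algebra.Apartness.Bundles using (HeytingField)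
import Algebra.Apartness.Properties.HeytingCommutativeRing as Apartness
open import Algebra.Bundles using (CommutativeMonoid; CommutativeRing; Ring)
open import Algebra.Module.Bundles using (LeftModule)
open import Algebra.Module.Morphism.Structures using (module LeftModuleMorphisms)
import Algebra.Properties.CommutativeMonoid.Mult as Multiple
import Algebra.Properties.CommutativeSemigroup as CommutativeSemigroupProperties
import Algebra.Properties.Group as GroupProperties
import Algebra.Properties.Ring as RingProperties
import Algebra.Properties.Semiring.Exp as Exponentiation
import Algebra.Properties.Semiring.Sum as Summation
open import Data.Bool.Base using (T; true; false; if_then_else_)
open import Data.Fin.Base using (Fin; zero; suc)
import Data.Fin.Properties as Fin
open import Data.Fin.Subset as Subset
  using (Subset; _∩_; ⁅_⁆; ⋃; Nonempty; Empty; ∣_∣)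
import Data.Fin.Subset.Properties as Subset
open import Data.List.Base as List
  using (List; []; _∷_; _++_; length; upTo; applyUpTo; concatMap; mapMaybe)
import Data.List.Membership.DecPropositional as DecMembership
import Data.List.Membership.Propositional as List hiding (find)
open import Data.List.Membership.Propositional using (find)
import Data.List.Membership.Propositional.Properties as List
import Data.List.Membership.Propositional.Properties.WithK as List
import Data.List.Properties as List
open import Data.List.Relation.Binary.BagAndSetEquality using (∼bag⇒↭)
open import Data.List.Relation.Binary.Disjoint.Propositional using (Disjoint)
open import Data.List.Relation.Binary.Permutation.Propositional as ↭
  using (_↭_; ↭-reflexive; ↭-sym; ↭-trans; ↭⇒↭ₛ)
import Data.List.Relation.Binary.Permutation.Propositional.Properties as ↭
import Data.List.Relation.Binary.Permutation.Setoid.Properties as ↭ₛ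
import Data.List.Relation.Binary.Sublist.Propositional as Sublist
import Data.List.Relation.Binary.Sublist.Propositional.Properties as Sublist
open import Data.List.Relation.Unary.All as All using (All; []; _∷_; all?)
import Data.List.Relation.Unary.All.Properties as All
open import Data.List.Relation.Unary.AllPairs as AllPairs using (AllPairs; []; _∷_)
import Data.List.Relation.Unary.AllPairs.Properties as AllPairs
open import Data.List.Relation.Unary.Any as Any using (Any; here; there; any?)
import Data.List.Relation.Unary.Any.Properties as Any
open import Data.List.Relation.Unary.Unique.Propositional using (Unique)
import Data.List.Relation.Unary.Unique.Propositional.Properties as Unique
import Data.Maybe.Base as Maybe
open import Data.Nat.Base as ℕ using (ℕ; zero; suc; z≤n; s≤s)
import Data.Nat.Properties as ℕ
open import Data.Product.Base using (∃; _×_; _,_; proj₁; proj₂)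
open import Data.Sum.Base using (_⊎_; inj₁; inj₂; [_,_]′)
open import Data.Vec.Base as Vec using ([]; _∷_; lookup; here; there)
open import Data.Vec.Functional using (Vector)
import Data.Vec.Properties as Vec
open import Function.Base using (_∘_; _$_; id)
open import Function.Bundles using (_⇔_; mk⇔; Equivalence)
open import Function.Properties.Equivalence using () renaming (sym to ⇔-sym; trans to ⇔-trans)
import Relation.Binary.Construct.StrictToNonStrict as StrictToNonStrict
open import Relation.Binary.Definitions using (tri<; tri≈; tri>)
open import Relation.Binary.PropositionalEquality as ≡ using (_≡_; _≢_; _≗_)
import Relation.Binary.Reasoning.Setoid as SetoidReasoning
open import Relation.Binary.Structures using (IsStrictTotalOrder)
open import Relation.Nullary using (Dec; yes; no; does; ¬_; contradiction; dec⇒maybe)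
open import Relation.Nullary.Decidable as Decidable
  using (dec-true; dec-false; does-⇔; from-yes; toSum; _→-dec_; _×-dec_; ¬?)
open import Relation.Unary using (Pred; Decidable; ∁; _∈_; _∉_; _⊆_; _≐_; _∪_; _⊂_)

open Equivalence using (to; from)

-- The two harder inclusions, kernel into relations and image into SC, come from one family of
-- linear maps from series back to HGP: `expandBelow k`, with x congruent to `expandBelow k (Υ x)`
-- modulo relations for all large k. If Υ x vanishes, linearity makes the right side zero, so x is a
-- combination of relations. For arbitrary x, Υ of the right side is a combination of the N, so Υ x
-- lies in SC. No linear independence in HGP has to be established: the congruence is compatible
-- with sums and scalars, so induction on the formal expression reduces it to a single polytope,
-- where Υ is prescribed. The obstacle is that a coefficient is read at a word while the splitting
-- of a family is still in progress. It is overcome by proving that each subtree reads a series only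
-- at words compatible with the choices made so far, so that the two halves of a splitting do not
-- disturb each other. Equality in a Heyting field need not be decidable; all case distinctions
-- therefore concern subsets, compositions, degrees and signs of real numbers, never scalars of K.

private
  variable
    n : ℕ

-- Set compositions and words, described by unique minimizers

module Combinatorics where

  open ≡ using (refl; sym; trans; cong; subst)

  Minimizer : (Fin n → ℕ) → Subset n → Fin n → Set
  Minimizer κ A i = i Subset.∈ A × (∀ {j} → j Subset.∈ A → κ i ℕ.≤ κ j)

  -- The common form of two conditions: with κ the block index it says that a composition lies in
  -- Orth A, and with κ the letters of a word it says that the word is generic for the simplex of A.
  UniqueMinimizer : (Fin n → ℕ) → Subset n → Set
  UniqueMinimizer κ A = ∃ λ i → Minimizer κ A i × (∀ {j} → Minimizer κ A j → j ≡ i)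

  UniqueMinimizer-cong : ∀ {κ μ : Fin n → ℕ} → κ ≗ μ → ∀ {A} →
                         UniqueMinimizer κ A → UniqueMinimizer μ A
  UniqueMinimizer-cong {κ = κ} {μ} κ≗μ (i , min , uniq) =
    i , along κ≗μ min , λ min′ → uniq (along (sym ∘ κ≗μ) min′)
    where
    along : ∀ {κ μ : Fin _ → ℕ} → κ ≗ μ → ∀ {A i} → Minimizer κ A i → Minimizer μ A i
    along eq (i∈A , i≤) = i∈A , λ {j} j∈A → subst (ℕ._≤ _) (eq _) (subst (_ ℕ.≤_) (eq j) (i≤ j∈A))

  minimizer-exists : (κ : Fin n → ℕ) (A : Subset n) → Nonempty A → ∃ (Minimizer κ A)
  minimizer-exists κ [] (() , _)
  minimizer-exists κ (s ∷ A) A≠∅ with Subset.nonempty? A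
  minimizer-exists κ (Subset.inside ∷ A) A≠∅ | yes ne with minimizer-exists (κ ∘ suc) A ne
  ... | i , i∈A , i≤ with ℕ.≤-total (κ zero) (κ (suc i))
  ...   | inj₁ 0≤i = zero , here , λ { here → ℕ.≤-refl ; (there j∈A) → ℕ.≤-trans 0≤i (i≤ j∈A) }
  ...   | inj₂ i≤0 = suc i , there i∈A , λ { here → i≤0 ; (there j∈A) → i≤ j∈A }
  minimizer-exists κ (Subset.outside ∷ A) A≠∅ | yes ne with minimizer-exists (κ ∘ suc) A ne
  ... | i , i∈A , i≤ = suc i , there i∈A , λ { (there j∈A) → i≤ j∈A }
  minimizer-exists κ (Subset.inside ∷ A) A≠∅ | no ¬ne =
    zero , here , λ { here → ℕ.≤-refl ; (there j∈A) → contradiction (_ , j∈A) ¬ne }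
  minimizer-exists κ (Subset.outside ∷ A) (suc i , there i∈A) | no ¬ne = contradiction (i , i∈A) ¬ne

  ∣A∣≡1⇔∃! : (A : Subset n) → ∣ A ∣ ≡ 1 ⇔ ∃ λ i → i Subset.∈ A × (∀ {j} → j Subset.∈ A → j ≡ i)
  ∣A∣≡1⇔∃! {n} A = mk⇔ f g
    where
    f : ∣ A ∣ ≡ 1 → ∃ λ i → i Subset.∈ A × (∀ {j} → j Subset.∈ A → j ≡ i)
    f ∣A∣≡1 with Subset.nonempty? A
    ... | no ∅ with () ← trans (sym (Subset.∣⊥∣≡0 n)) (trans (sym (cong ∣_∣ (Subset.Empty-unique ∅))) ∣A∣≡1)
    ... | yes (i , i∈A) = i , i∈A , uniq
      where
      uniq : ∀ {j} → j Subset.∈ A → j ≡ i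
      uniq {j} j∈A with j Fin.≟ i
      ... | yes j≡i = j≡i
      ... | no j≢i = contradiction ∣A∣≡1 (ℕ.>⇒≢ (ℕ.≤-<-trans
              (subst (ℕ._≤ ∣ A Subset.- i ∣) (Subset.∣⁅x⁆∣≡1 j) (Subset.p⊆q⇒∣p∣≤∣q∣ ⁅j⁆⊆A-i))
              (Subset.x∈p⇒∣p-x∣<∣p∣ i∈A)))
        where
        ⁅j⁆⊆A-i : ⁅ j ⁆ Subset.⊆ A Subset.- i
        ⁅j⁆⊆A-i x∈ = subst (Subset._∈ A Subset.- i) (sym (Subset.x∈⁅y⁆⇒x≡y j x∈)) (Subset.x∈p∧x≢y⇒x∈p-y j∈A j≢i)
    g : (∃ λ i → i Subset.∈ A × (∀ {j} → j Subset.∈ A → j ≡ i)) → ∣ A ∣ ≡ 1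
    g (i , i∈A , uniq) = trans (cong ∣_∣ (Subset.⊆-antisym
      (λ j∈A → subst (Subset._∈ ⁅ i ⁆) (sym (uniq j∈A)) (Subset.x∈⁅x⁆ i))
      (λ j∈i → subst (Subset._∈ A) (sym (Subset.x∈⁅y⁆⇒x≡y i j∈i)) i∈A))) (Subset.∣⁅x⁆∣≡1 i)

  -- The function in the where block of _∥_ has no name outside Defs; here it
  -- is recovered by unification.

  mutual
    firstMeet : Subset n → SetComposition n → List (Subset n) → Subset n
    firstMeet = _

    ∥≡firstMeet : (A : Subset n) (π : SetComposition n) → A ∥ π ≡ firstMeet A π (blocks π)
    ∥≡firstMeet A π with blocks π
    ... | Ss = refl

  -- Position of the first block containing i. An element in no block gets the number of blocks;
  -- this default never arises for a set composition, whose blocks cover.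
  index : List (Subset n) → Fin n → ℕ
  index []       i = 0
  index (S ∷ Ss) i = if does (i Subset.∈? S) then 0 else suc (index Ss i)

  index-here : ∀ {S} {Ss : List (Subset n)} {i} → i Subset.∈ S → index (S ∷ Ss) i ≡ 0
  index-here {S = S} {i = i} i∈S rewrite dec-true (i Subset.∈? S) i∈S = refl

  index-there : ∀ {S} {Ss : List (Subset n)} {i} → i Subset.∉ S → index (S ∷ Ss) i ≡ suc (index Ss i)
  index-there {S = S} {i = i} i∉S rewrite dec-false (i Subset.∈? S) i∉S = refl

  module _ (A : Subset n) (π : SetComposition n) where

    -- If the head misses A, all indices on A rise by one and the minimizers stay the same; if it
    -- meets A, the minimizers are the elements of index 0. Covering excludes running out of blocks,
    -- where the index is constant but the meet is empty.
    firstMeet-minimizer : ∀ Ss → (∀ {i} → i Subset.∈ A → Any (i Subset.∈_) Ss) →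
                          ∀ i → i Subset.∈ firstMeet A π Ss ⇔ Minimizer (index Ss) A i
    firstMeet-minimizer [] cover i =
      mk⇔ (λ i∈⊥ → contradiction i∈⊥ Subset.∉⊥) (λ (i∈A , _) → contradiction (cover i∈A) λ ())
    firstMeet-minimizer (S ∷ Ss) cover i with Subset.nonempty? (A ∩ S)
    ... | yes (j , j∈A∩S) = mk⇔ f g
      where
      f : i Subset.∈ A ∩ S → Minimizer (index (S ∷ Ss)) A i
      f i∈A∩S with i∈A , i∈S ← Subset.x∈p∩q⁻ A S i∈A∩S =
        i∈A , λ _ → subst (ℕ._≤ _) (sym (index-here {Ss = Ss} i∈S)) z≤n
      g : Minimizer (index (S ∷ Ss)) A i → i Subset.∈ A ∩ S
      g (i∈A , i≤) with i Subset.∈? S | i≤ {j} (proj₁ (Subset.x∈p∩q⁻ A S j∈A∩S))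
      ... | yes i∈S | _ = Subset.x∈p∩q⁺ (i∈A , i∈S)
      ... | no _ | i≤j with () ← subst (_ ℕ.≤_) (index-here {Ss = Ss} (proj₂ (Subset.x∈p∩q⁻ A S j∈A∩S))) i≤j
    ... | no A∩S=∅ = ⇔-trans (firstMeet-minimizer Ss cover′ i) (mk⇔ f g)
      where
      ∉S : ∀ {j} → j Subset.∈ A → j Subset.∉ S
      ∉S j∈A j∈S = A∩S=∅ (_ , Subset.x∈p∩q⁺ (j∈A , j∈S))
      cover′ : ∀ {j} → j Subset.∈ A → Any (j Subset.∈_) Ss
      cover′ j∈A with cover j∈A
      ... | here j∈S = contradiction j∈S (∉S j∈A)
      ... | there j∈ = j∈
      f : Minimizer (index Ss) A i → Minimizer (index (S ∷ Ss)) A i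
      f (i∈A , i≤) = i∈A , λ {j} j∈A → subst (ℕ._≤ index (S ∷ Ss) j) (sym (index-there {Ss = Ss} (∉S i∈A)))
        (subst (_ ℕ.≤_) (sym (index-there {Ss = Ss} (∉S j∈A))) (s≤s (i≤ j∈A)))
      g : Minimizer (index (S ∷ Ss)) A i → Minimizer (index Ss) A i
      g (i∈A , i≤) = i∈A , λ {j} j∈A → ℕ.s≤s⁻¹
        (subst (_ ℕ.≤_) (index-there {Ss = Ss} (∉S j∈A))
          (subst (ℕ._≤ index (S ∷ Ss) j) (index-there {Ss = Ss} (∉S i∈A)) (i≤ j∈A)))

    -- An empty block meets nothing. Hence a word can be analysed through all its levels, among
    -- which the index of i is exactly the letter at i.
    firstMeet-filter : ∀ Ss → firstMeet A π (List.filter Subset.nonempty? Ss) ≡ firstMeet A π Ss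
    firstMeet-filter [] = refl
    firstMeet-filter (S ∷ Ss) with Subset.nonempty? S
    ... | yes _ with does (Subset.nonempty? (A ∩ S))
    ...   | true  = refl
    ...   | false = firstMeet-filter Ss
    firstMeet-filter (S ∷ Ss) | no S=∅
      rewrite dec-false (Subset.nonempty? (A ∩ S)) (λ (i , i∈) → S=∅ (i , proj₂ (Subset.x∈p∩q⁻ A S i∈))) =
      firstMeet-filter Ss

  ∈⋃⇔Any : (Ss : List (Subset n)) {i : Fin n} → i Subset.∈ ⋃ Ss ⇔ Any (i Subset.∈_) Ss
  ∈⋃⇔Any [] = mk⇔ (λ i∈⊥ → contradiction i∈⊥ Subset.∉⊥) (λ ())
  ∈⋃⇔Any (S ∷ Ss) {i} = mk⇔ f g
    where
    f : i Subset.∈ S Subset.∪ ⋃ Ss → Any (i Subset.∈_) (S ∷ Ss)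
    f i∈ with Subset.x∈p∪q⁻ S (⋃ Ss) i∈
    ... | inj₁ i∈S = here i∈S
    ... | inj₂ i∈⋃ = there (to (∈⋃⇔Any Ss) i∈⋃)
    g : Any (i Subset.∈_) (S ∷ Ss) → i Subset.∈ S Subset.∪ ⋃ Ss
    g (here i∈S)  = Subset.x∈p∪q⁺ (inj₁ i∈S)
    g (there any) = Subset.x∈p∪q⁺ {p = S} (inj₂ (from (∈⋃⇔Any Ss) any))

  minimizer⇒orth⇔ : ∀ {κ : Fin n → ℕ} {A π} → (∀ i → i Subset.∈ A ∥ π ⇔ Minimizer κ A i) →
                    π ∈ Orth A ⇔ UniqueMinimizer κ A
  minimizer⇒orth⇔ {A = A} {π} eqv = ⇔-trans (∣A∣≡1⇔∃! (A ∥ π)) (mk⇔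
    (λ (i , i∈ , uniq) → i , to (eqv i) i∈ , λ min → uniq (from (eqv _) min))
    (λ (i , min , uniq) → i , from (eqv i) min , λ j∈ → uniq (to (eqv _) j∈)))

  orth⇔uniqueMinimizer-index : (A : Subset n) (π : SetComposition n) →
                               π ∈ Orth A ⇔ UniqueMinimizer (index (blocks π)) A
  orth⇔uniqueMinimizer-index A π = minimizer⇒orth⇔ {A = A} {π} λ i →
    subst (λ B → i Subset.∈ B ⇔ Minimizer (index (blocks π)) A i) (sym (∥≡firstMeet A π))
      (firstMeet-minimizer A π (blocks π)
        (λ _ → to (∈⋃⇔Any (blocks π)) (subst (_ Subset.∈_) (sym covering) Subset.∈⊤)) i)
    where open IsSetComposition (SetComposition.isSetComposition π)

  -- Compositions with equal block lists may carry different proofs, so transport passes through the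
  -- minimizer criterion, which sees only the blocks.
  orth-blocks : ∀ (A : Subset n) {π τ} → blocks π ≡ blocks τ → π ∈ Orth A → τ ∈ Orth A
  orth-blocks A {π} {τ} eq = from (orth⇔uniqueMinimizer-index A τ) ∘
    subst (λ Ss → UniqueMinimizer (index Ss) A) eq ∘ to (orth⇔uniqueMinimizer-index A π)

  ∈-level⇔ : (w : Word n) (k : ℕ) (i : Fin n) → i Subset.∈ level w k ⇔ lookup w i ≡ k
  ∈-level⇔ w k i = mk⇔ f g
    where
    lk : lookup (level w k) i ≡ does (lookup w i ℕ.≟ k)
    lk = Vec.lookup-map i _ w
    f : i Subset.∈ level w k → lookup w i ≡ k
    f i∈ = ℕ.≡ᵇ⇒≡ _ k (subst T (trans (sym (Vec.[]=⇒lookup i∈)) lk) _)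
    g : lookup w i ≡ k → i Subset.∈ level w k
    g eq = Vec.lookup⇒[]= i _ (trans lk (dec-true (lookup w i ℕ.≟ k) eq))

  index-applyUpTo : ∀ (f : ℕ → Subset n) m {i} l → l ℕ.< m → i Subset.∈ f l → (∀ {k} → i Subset.∈ f k → k ≡ l) →
                    index (applyUpTo f m) i ≡ l
  index-applyUpTo f (suc m) zero    l<m i∈ uniq = index-here {Ss = applyUpTo (f ∘ suc) m} i∈
  index-applyUpTo f (suc m) (suc l) l<m i∈ uniq =
    trans (index-there {Ss = applyUpTo (f ∘ suc) m} (λ i∈f0 → contradiction (uniq i∈f0) λ ()))
          (cong suc (index-applyUpTo (f ∘ suc) m l (ℕ.s<s⁻¹ l<m) i∈ (ℕ.suc-injective ∘ uniq)))

  letterBound : Word n → ℕ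
  letterBound w = suc (Vec.foldr′ ℕ._⊔_ 0 w)

  lookup<letterBound : (w : Word n) (i : Fin n) → lookup w i ℕ.< letterBound w
  lookup<letterBound (l ∷ w) zero    = s≤s (ℕ.m≤m⊔n l _)
  lookup<letterBound (l ∷ w) (suc i) = ℕ.<-≤-trans (lookup<letterBound w i) (s≤s (ℕ.m≤n⊔m l _))

  levels : Word n → List (Subset n)
  levels w = List.map (level w) (upTo (letterBound w))

  index-levels : (w : Word n) (i : Fin n) → index (levels w) i ≡ lookup w i
  index-levels w i = trans (cong (λ Ss → index Ss i) (List.map-upTo (level w) (letterBound w)))
    (index-applyUpTo (level w) (letterBound w) (lookup w i) (lookup<letterBound w i)
      (from (∈-level⇔ w _ i) refl) (λ i∈ → sym (to (∈-level⇔ w _ i) i∈)))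

  levels-cover : (w : Word n) (i : Fin n) → Any (i Subset.∈_) (levels w)
  levels-cover w i = Any.map⁺ (List.lose (List.∈-upTo⁺ (lookup<letterBound w i)) (from (∈-level⇔ w _ i) refl))

  wordBlocks-isSetComposition : (w : Word n) → IsSetComposition (wordBlocks w)
  wordBlocks-isSetComposition w = record
    { nonempty = All.all-filter Subset.nonempty? (levels w)
    ; disjoint = AllPairs.filter⁺ Subset.nonempty?
        (AllPairs.map⁺ (AllPairs.map apart (Unique.upTo⁺ (letterBound w))))
    ; covering = Subset.⊆-antisym Subset.⊆⊤ λ {i} _ → from (∈⋃⇔Any (wordBlocks w)) (cover i)
    }
    where
    apart : ∀ {k l} → k ≢ l → Empty (level w k ∩ level w l)
    apart k≢l (i , i∈) with i∈k , i∈l ← Subset.x∈p∩q⁻ (level w _) (level w _) i∈ =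
      k≢l (trans (sym (to (∈-level⇔ w _ i) i∈k)) (to (∈-level⇔ w _ i) i∈l))
    cover : ∀ i → Any (i Subset.∈_) (wordBlocks w)
    cover i with S , S∈ , i∈S ← find (levels-cover w i) =
      List.lose (List.∈-filter⁺ Subset.nonempty? S∈ (i , i∈S)) i∈S

  composition : Word n → SetComposition n
  composition w = wordBlocks w since wordBlocks-isSetComposition w

  orth⇔uniqueMinimizer : (A : Subset n) (w : Word n) →
                         composition w ∈ Orth A ⇔ UniqueMinimizer (lookup w) A
  orth⇔uniqueMinimizer A w = ⇔-trans
    (minimizer⇒orth⇔ {A = A} {composition w} λ i →
      subst (λ B → i Subset.∈ B ⇔ Minimizer (index (levels w)) A i)
        (sym (trans (∥≡firstMeet A (composition w)) (firstMeet-filter A (composition w) (levels w))))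
        (firstMeet-minimizer A (composition w) (levels w) (λ _ → levels-cover w _) i))
    (mk⇔ (UniqueMinimizer-cong (index-levels w)) (UniqueMinimizer-cong (sym ∘ index-levels w)))

  wordOf : SetComposition n → Word n
  wordOf π = Vec.tabulate (index (blocks π))

  -- Both sides reduce to minimizing the block index of π. This makes `wordOf π` a valid evaluation
  -- point for the class of π.
  orth-wordOf : (A : Subset n) (π : SetComposition n) →
                π ∈ Orth A ⇔ composition (wordOf π) ∈ Orth A
  orth-wordOf A π = ⇔-trans (orth⇔uniqueMinimizer-index A π) (⇔-trans
    (mk⇔ (UniqueMinimizer-cong (sym ∘ eq)) (UniqueMinimizer-cong eq))
    (⇔-sym (orth⇔uniqueMinimizer A (wordOf π))))
    where
    eq : lookup (wordOf π) ≗ index (blocks π)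
    eq = Vec.lookup∘tabulate (index (blocks π))

  -- Enumeration of subsets and of set compositions

  ∈-subsets : (A : Subset n) → A List.∈ subsets n
  ∈-subsets [] = here refl
  ∈-subsets (Subset.outside ∷ A) = List.∈-++⁺ˡ (List.∈-map⁺ (Subset.outside ∷_) (∈-subsets A))
  ∈-subsets (Subset.inside ∷ A) = List.∈-++⁺ʳ _ (List.∈-map⁺ (Subset.inside ∷_) (∈-subsets A))

  subsets-unique : ∀ n → Unique (subsets n)
  subsets-unique zero    = [] ∷ []
  subsets-unique (suc n) = Unique.++⁺
    (Unique.map⁺ Vec.∷-injectiveʳ (subsets-unique n)) (Unique.map⁺ Vec.∷-injectiveʳ (subsets-unique n))
    λ (A∈out , A∈in) → out≢in (trans (sym (proj₂ (proj₂ (List.∈-map⁻ _ A∈out))))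
      (proj₂ (proj₂ (List.∈-map⁻ _ A∈in))))
    where
    out≢in : ∀ {A B : Subset n} → Subset.outside ∷ A ≢ Subset.inside ∷ B
    out≢in ()

  ∈-nonemptySubsets : {A : Subset n} → Nonempty A → A List.∈ nonemptySubsets n
  ∈-nonemptySubsets {A = A} = List.∈-filter⁺ Subset.nonempty? (∈-subsets A)

  nonemptySubsets-nonempty : ∀ n → All Nonempty (nonemptySubsets n)
  nonemptySubsets-nonempty n = All.all-filter Subset.nonempty? (subsets n)

  nonemptySubsets-unique : ∀ n → Unique (nonemptySubsets n)
  nonemptySubsets-unique n = Unique.filter⁺ Subset.nonempty? (subsets-unique n)

  module _ {a} {A : Set a} where

    ∈-listsOfLength⁻ : ∀ k {xs ys : List A} → ys List.∈ listsOfLength k xs → length ys ≡ k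
    ∈-listsOfLength⁻ zero (here refl) = refl
    ∈-listsOfLength⁻ (suc k) {xs} ys∈ with List.∈-cartesianProductWith⁻ _∷_ xs (listsOfLength k xs) ys∈
    ... | y , ys , _ , ys∈′ , refl = cong suc (∈-listsOfLength⁻ k ys∈′)

    ∈-listsOfLength⁺ : ∀ {xs} → (∀ x → x List.∈ xs) → (ys : List A) → ys List.∈ listsOfLength (length ys) xs
    ∈-listsOfLength⁺ all∈ []       = here refl
    ∈-listsOfLength⁺ all∈ (y ∷ ys) = List.∈-cartesianProductWith⁺ _∷_ (all∈ y) (∈-listsOfLength⁺ all∈ ys)

    listsOfLength-unique : ∀ k {xs : List A} → Unique xs → Unique (listsOfLength k xs)
    listsOfLength-unique zero    u = [] ∷ []
    listsOfLength-unique (suc k) u = Unique.cartesianProductWith⁺ _∷_ List.∷-injective u (listsOfLength-unique k u)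

  candidates : ∀ n → List (List (Subset n))
  candidates n = concatMap (λ k → listsOfLength k (subsets n)) (upTo (suc n))

  candidates-unique : ∀ n → Unique (candidates n)
  candidates-unique n = Unique.concat⁺ {xss = List.map (λ k → listsOfLength k (subsets n)) (upTo (suc n))}
    (All.map⁺ (All.universal (λ k → listsOfLength-unique k (subsets-unique n)) (upTo (suc n))))
    (AllPairs.map⁺ (AllPairs.map apart (Unique.upTo⁺ (suc n))))
    where
    apart : ∀ {k l} → k ≢ l → Disjoint (listsOfLength k (subsets n)) (listsOfLength l (subsets n))
    apart k≢l (∈k , ∈l) = k≢l (trans (sym (∈-listsOfLength⁻ _ ∈k)) (∈-listsOfLength⁻ _ ∈l))

  -- Each block contains an element outside the union of the later ones. The resulting bound n on
  -- the number of blocks makes `candidates` exhaustive.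
  length≤∣⋃∣ : ∀ {Ss : List (Subset n)} → All Nonempty Ss → AllPairs (λ S T → Empty (S ∩ T)) Ss →
               length Ss ℕ.≤ ∣ ⋃ Ss ∣
  length≤∣⋃∣ [] [] = z≤n
  length≤∣⋃∣ {Ss = S ∷ Ss} ((i , i∈S) ∷ ne) (dj ∷ djs) = ℕ.≤-<-trans (length≤∣⋃∣ ne djs)
    (Subset.p⊂q⇒∣p∣<∣q∣ (Subset.q⊆p∪q S (⋃ Ss) , i , Subset.x∈p∪q⁺ (inj₁ i∈S) , i∉⋃))
    where
    i∉⋃ : i Subset.∉ ⋃ Ss
    i∉⋃ i∈⋃ with T , T∈Ss , i∈T ← find (to (∈⋃⇔Any Ss) i∈⋃) =
      All.lookup dj T∈Ss (i , Subset.x∈p∩q⁺ (i∈S , i∈T))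

  ∈-candidates : (π : SetComposition n) → blocks π List.∈ candidates n
  ∈-candidates {n} (Ss since isSC) = List.∈-concatMap⁺ (λ k → listsOfLength k (subsets n)) {xs = upTo (suc n)}
    (List.lose (List.∈-upTo⁺ (s≤s (ℕ.≤-trans (length≤∣⋃∣ nonempty disjoint) (Subset.∣p∣≤n (⋃ Ss)))))
               (∈-listsOfLength⁺ ∈-subsets Ss))
    where open IsSetComposition isSC

  -- Forgetting the proofs turns the enumeration into a plain filter, from which uniqueness and
  -- completeness are inherited at the level of block lists.
  map-blocks-setCompositions : ∀ n →
    List.map blocks (setCompositions n) ≡ List.filter isSetComposition? (candidates n)
  map-blocks-setCompositions n = map-mapMaybe isSetComposition? (candidates n)
    where
    -- With the decision procedure a variable, one case analysis on its result rewrites both sides.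
    map-mapMaybe : (isSC? : Decidable (IsSetComposition {n})) → ∀ Sss →
      List.map blocks (mapMaybe (λ Ss → Maybe.map (Ss since_) (dec⇒maybe (isSC? Ss))) Sss)
      ≡ List.filter isSC? Sss
    map-mapMaybe isSC? []         = refl
    map-mapMaybe isSC? (Ss ∷ Sss) with isSC? Ss
    ... | yes _ = cong (Ss ∷_) (map-mapMaybe isSC? Sss)
    ... | no  _ = map-mapMaybe isSC? Sss

  setCompositions-unique : ∀ n → AllPairs (λ π τ → blocks π ≢ blocks τ) (setCompositions n)
  setCompositions-unique n = AllPairs.map⁻ (subst Unique (sym (map-blocks-setCompositions n))
    (Unique.filter⁺ isSetComposition? (candidates-unique n)))

  setCompositions-complete : (π : SetComposition n) → ∃ λ τ → τ List.∈ setCompositions n × blocks π ≡ blocks τ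
  setCompositions-complete {n} π = List.∈-map⁻ blocks (subst (blocks π List.∈_) (sym (map-blocks-setCompositions n))
    (List.∈-filter⁺ isSetComposition? (∈-candidates π) (SetComposition.isSetComposition π)))

open Combinatorics

-- Order arithmetic in the real numbers

module Geometry {r} (ℝ : RealNumbers r) where

  open RealNumbers ℝ hiding (zero)
  open Polytopes ℝ
  open IsStrictTotalOrder isStrictTotalOrder
    using (compare; <-resp-≈; <-respˡ-≈; <-respʳ-≈) renaming (trans to <-trans; irrefl to <-irrefl)
  open Summation semiring
  open Multiple +-commutativeMonoid renaming (_×_ to _·_)
  open SetoidReasoning setoid

  private
    variable
      a b x y z : Carrier

  private module ≤ = StrictToNonStrict _≈_ _<_

  ≤-refl : x ≤ᴿ x
  ≤-refl = inj₂ refl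

  ≤-trans : x ≤ᴿ y → y ≤ᴿ z → x ≤ᴿ z
  ≤-trans = ≤.trans isEquivalence <-resp-≈ <-trans

  ≤-resp : a ≈ x → b ≈ y → a ≤ᴿ b → x ≤ᴿ y
  ≤-resp p q = ≤.≤-respˡ-≈ sym trans <-respˡ-≈ p ∘ ≤.≤-respʳ-≈ trans <-respʳ-≈ q

  ≤⇒≯ : x ≤ᴿ y → ¬ y < x
  ≤⇒≯ (inj₁ x<y) y<x = <-irrefl refl (<-trans x<y y<x)
  ≤⇒≯ (inj₂ x≈y) y<x = <-irrefl (sym x≈y) y<x

  ≮⇒≥ : ¬ x < y → y ≤ᴿ x
  ≮⇒≥ {x} {y} x≮y with compare x y
  ... | tri< x<y _ _ = contradiction x<y x≮y
  ... | tri≈ _ x≈y _ = inj₂ (sym x≈y)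
  ... | tri> _ _ y<x = inj₁ y<x

  0≤∧≯0⇒≈0 : 0# ≤ᴿ x → ¬ 0# < x → x ≈ 0#
  0≤∧≯0⇒≈0 (inj₁ 0<x) ≯ = contradiction 0<x ≯
  0≤∧≯0⇒≈0 (inj₂ 0≈x) _ = sym 0≈x

  0<? : ∀ x → Dec (0# < x)
  0<? x with compare 0# x
  ... | tri< 0<x _ _ = yes 0<x
  ... | tri≈ ¬< _ _ = no ¬<
  ... | tri> ¬< _ _ = no ¬<

  1≉0 : ¬ 1# ≈ 0#
  1≉0 1≈0 = proj₂ (tight 1# 0#) 1≈0 (Apartness.1#0 heytingCommutativeRing)
    where open HeytingField heytingField using (tight; heytingCommutativeRing)

  +-monoʳ-≤ : ∀ x {y z} → y ≤ᴿ z → x + y ≤ᴿ x + z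
  +-monoʳ-≤ x (inj₁ y<z) = inj₁ (+-monoʳ-< x y<z)
  +-monoʳ-≤ x (inj₂ y≈z) = inj₂ (+-congˡ y≈z)

  +-monoˡ-< : ∀ x {y z} → y < z → y + x < z + x
  +-monoˡ-< x y<z = <-respˡ-≈ (+-comm _ _) (<-respʳ-≈ (+-comm _ _) (+-monoʳ-< x y<z))

  +-monoˡ-≤ : ∀ x {y z} → y ≤ᴿ z → y + x ≤ᴿ z + x
  +-monoˡ-≤ x = ≤-resp (+-comm _ _) (+-comm _ _) ∘ +-monoʳ-≤ x

  +-mono-≤ : a ≤ᴿ b → x ≤ᴿ y → a + x ≤ᴿ b + y
  +-mono-≤ {x = x} a≤b x≤y = ≤-trans (+-monoˡ-≤ x a≤b) (+-monoʳ-≤ _ x≤y)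

  +-mono-<-≤ : a < b → x ≤ᴿ y → a + x < b + y
  +-mono-<-≤ {x = x} a<b x≤y = ≤.<-≤-trans <-trans <-respʳ-≈ (+-monoˡ-< x a<b) (+-monoʳ-≤ _ x≤y)

  +-mono-≤-< : a ≤ᴿ b → x < y → a + x < b + y
  +-mono-≤-< {x = x} a≤b x<y = ≤.≤-<-trans sym <-trans <-respˡ-≈ (+-monoˡ-≤ x a≤b) (+-monoʳ-< _ x<y)

  +-cancelʳ-≤ : ∀ x {y z} → y + x ≤ᴿ z + x → y ≤ᴿ z
  +-cancelʳ-≤ x y+x≤z+x = ≮⇒≥ λ z<y → ≤⇒≯ y+x≤z+x (+-monoˡ-< x z<y)

  0<1 : 0# < 1#
  0<1 with compare 0# 1#
  ... | tri< 0<1 _ _ = 0<1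
  ... | tri≈ _ 0≈1 _ = contradiction (sym 0≈1) 1≉0
  -- Here -1 would be positive, and so would its square, which is 1.
  ... | tri> _ _ 1<0 = contradiction (<-trans 1<0 0<1′) (<-irrefl refl)
    where
    open RingProperties ring using (-‿distribˡ-*; -‿distribʳ-*; -‿involutive)
    0<-1 : 0# < - 1#
    0<-1 = <-respˡ-≈ (-‿inverseˡ 1#) (<-respʳ-≈ (+-identityʳ _) (+-monoʳ-< (- 1#) 1<0))
    0<1′ : 0# < 1#
    0<1′ = <-respʳ-≈ (trans (sym (-‿distribˡ-* _ _)) (trans (-‿cong (*-identityˡ _)) (-‿involutive 1#)))
                     (*-pos 0<-1 0<-1)

  *-nonneg : 0# ≤ᴿ a → 0# ≤ᴿ b → 0# ≤ᴿ a * b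
  *-nonneg (inj₁ 0<a) (inj₁ 0<b) = inj₁ (*-pos 0<a 0<b)
  *-nonneg (inj₂ 0≈a) _          = inj₂ (sym (trans (*-congʳ (sym 0≈a)) (zeroˡ _)))
  *-nonneg (inj₁ _)   (inj₂ 0≈b) = inj₂ (sym (trans (*-congˡ (sym 0≈b)) (zeroʳ _)))

  *-monoˡ-< : 0# < a → x < y → a * x < a * y
  *-monoˡ-< {a} {x} {y} 0<a x<y = <-respˡ-≈ (+-identityʳ _) (<-respʳ-≈ eq (+-monoʳ-< (a * x) (*-pos 0<a 0<y-x)))
    where
    0<y-x : 0# < y + - x
    0<y-x = <-respˡ-≈ (-‿inverseʳ x) (+-monoˡ-< (- x) x<y)
    eq : a * x + a * (y + - x) ≈ a * y
    eq = begin
      a * x + a * (y + - x)  ≈⟨ distribˡ a x (y + - x) ⟨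
      a * (x + (y + - x))    ≈⟨ *-congˡ (trans (+-congˡ (+-comm y (- x))) (sym (+-assoc x (- x) y))) ⟩
      a * ((x + - x) + y)    ≈⟨ *-congˡ (trans (+-congʳ (-‿inverseʳ x)) (+-identityˡ y)) ⟩
      a * y                  ∎

  *-monoˡ-≤ : 0# < a → x ≤ᴿ y → a * x ≤ᴿ a * y
  *-monoˡ-≤ 0<a (inj₁ x<y) = inj₁ (*-monoˡ-< 0<a x<y)
  *-monoˡ-≤ 0<a (inj₂ x≈y) = inj₂ (*-congˡ x≈y)

  *-cancelˡ-≤ : 0# < a → a * x ≤ᴿ a * y → x ≤ᴿ y
  *-cancelˡ-≤ 0<a ax≤ay = ≮⇒≥ λ y<x → ≤⇒≯ ax≤ay (*-monoˡ-< 0<a y<x)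

  ·-zero : ∀ k → k · 0# ≈ 0#
  ·-zero k = trans (sym (sum-replicate k)) (sum-replicate-zero k)

  ·-nonneg : ∀ k → 0# ≤ᴿ x → 0# ≤ᴿ k · x
  ·-nonneg zero    0≤x = ≤-refl
  ·-nonneg (suc k) 0≤x = ≤-resp (+-identityˡ _) refl (+-mono-≤ 0≤x (·-nonneg k 0≤x))

  ·-monoˡ-≤ : ∀ {k l} → k ℕ.≤ l → 0# ≤ᴿ x → k · x ≤ᴿ l · x
  ·-monoˡ-≤ {l = l} ℕ.z≤n 0≤x = ·-nonneg l 0≤x
  ·-monoˡ-≤ {x} (s≤s k≤l) 0≤x = +-monoʳ-≤ x (·-monoˡ-≤ k≤l 0≤x)

  ·-monoˡ-< : ∀ {k l} → k ℕ.< l → 0# < x → k · x < l · x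
  ·-monoˡ-< {x} {k} {l} k<l 0<x = ≤.<-≤-trans <-trans <-respʳ-≈
    (<-respˡ-≈ (+-identityˡ _) (+-monoˡ-< (k · x) 0<x)) (·-monoˡ-≤ {k = suc k} {l} k<l (inj₁ 0<x))

  sum-≈0 : ∀ {t : Vector Carrier n} → (∀ i → t i ≈ 0#) → sum t ≈ 0#
  sum-≈0 {n} t≈0 = trans (sum-cong-≋ t≈0) (sum-replicate-zero n)

  sum-single : ∀ {t : Vector Carrier n} j → (∀ {i} → i ≢ j → t i ≈ 0#) → sum t ≈ t j
  sum-single zero    t≈0 = trans (+-congˡ (sum-≈0 (λ i → t≈0 {suc i} λ ()))) (+-identityʳ _)
  sum-single (suc j) t≈0 =
    trans (+-cong (t≈0 {zero} λ ()) (sum-single j (λ i≢j → t≈0 (i≢j ∘ Fin.suc-injective)))) (+-identityˡ _)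

  sum-mono-≤ : ∀ {s t : Vector Carrier n} → (∀ i → s i ≤ᴿ t i) → sum s ≤ᴿ sum t
  sum-mono-≤ {n = zero}  s≤t = ≤-refl
  sum-mono-≤ {n = suc n} s≤t = +-mono-≤ (s≤t zero) (sum-mono-≤ (s≤t ∘ suc))

  sum-mono-< : ∀ {s t : Vector Carrier n} → (∀ i → s i ≤ᴿ t i) → ∀ j → s j < t j → sum s < sum t
  sum-mono-< s≤t zero    s<t = +-mono-<-≤ s<t (sum-mono-≤ (s≤t ∘ suc))
  sum-mono-< s≤t (suc j) s<t = +-mono-≤-< (s≤t zero) (sum-mono-< (s≤t ∘ suc) j s<t)

  sum-nonneg : ∀ {t : Vector Carrier n} → (∀ i → 0# ≤ᴿ t i) → 0# ≤ᴿ sum t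
  sum-nonneg {n} 0≤t = ≤-resp (sum-replicate-zero n) refl (sum-mono-≤ 0≤t)

  ·-distrib-sum : ∀ k (t : Vector Carrier n) → sum (λ i → k · t i) ≈ k · sum t
  ·-distrib-sum {zero}  k t = sym (·-zero k)
  ·-distrib-sum {suc n} k t = trans (+-congˡ (·-distrib-sum k (t ∘ suc))) (sym (×-distrib-+ (t zero) _ k))

  -- Points, the pairing with a word, and simplices

  ≋-refl : {x : Point n} → x ≋ x
  ≋-refl i = refl

  ≋-sym : {x y : Point n} → x ≋ y → y ≋ x
  ≋-sym x≋y i = sym (x≋y i)

  ≋-trans : {x y z : Point n} → x ≋ y → y ≋ z → x ≋ z
  ≋-trans x≋y y≋z i = trans (x≋y i) (y≋z i)

  ⟨,⟩-cong : ∀ w {x y : Point n} → x ≋ y → ⟨ w , x ⟩ ≈ ⟨ w , y ⟩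
  ⟨,⟩-cong w x≋y = sum-cong-≋ (λ i → ×-congʳ (suc (lookup w i)) (x≋y i))

  ⟨,⟩-+ : ∀ w (x y : Point n) → ⟨ w , x +ₚ y ⟩ ≈ ⟨ w , x ⟩ + ⟨ w , y ⟩
  ⟨,⟩-+ w x y = trans (sum-cong-≋ (λ i → ×-distrib-+ (x i) (y i) (suc (lookup w i))))
    (∑-distrib-+ (λ i → suc (lookup w i) · x i) (λ i → suc (lookup w i) · y i))

  *-·-comm : ∀ a k x → a * (k · x) ≈ k · (a * x)
  *-·-comm a zero    x = zeroʳ a
  *-·-comm a (suc k) x = trans (distribˡ a x _) (+-congˡ (*-·-comm a k x))

  ⟨,⟩-* : ∀ w a (x : Point n) → ⟨ w , a *ₚ x ⟩ ≈ a * ⟨ w , x ⟩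
  ⟨,⟩-* w a x = trans (sum-cong-≋ (λ i → sym (*-·-comm a (suc (lookup w i)) (x i))))
    (sym (*-distribˡ-sum a (λ i → suc (lookup w i) · x i)))

  e-diag : (j : Fin n) → e j j ≈ 1#
  e-diag j rewrite dec-true (j Fin.≟ j) ≡.refl = refl

  e-off : {i j : Fin n} → i ≢ j → e j i ≈ 0#
  e-off {i = i} {j} i≢j rewrite dec-false (j Fin.≟ i) (i≢j ∘ ≡.sym) = refl

  e-nonneg : (j i : Fin n) → 0# ≤ᴿ e j i
  e-nonneg j i with does (j Fin.≟ i)
  ... | true  = inj₁ 0<1
  ... | false = ≤-refl

  sum-e : (j : Fin n) → sum (e j) ≈ 1#
  sum-e j = trans (sum-single j e-off) (e-diag j)

  ⟨,e⟩ : ∀ w (j : Fin n) → ⟨ w , e j ⟩ ≈ suc (lookup w j) · 1#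
  ⟨,e⟩ w j = trans
    (sum-single j (λ {i} i≢j → trans (×-congʳ (suc (lookup w i)) (e-off i≢j)) (·-zero (suc (lookup w i)))))
    (×-congʳ (suc (lookup w j)) (e-diag j))

  Closed : PointSet n → Set r
  Closed X = ∀ {x y} → x ≋ y → x ∈ X → y ∈ X

  simplex-closed : (J : Subset n) → Closed (simplex J)
  simplex-closed J x≋y (k , t , p , 0≤t , Σt≈1 , p∈ , x≋) = k , t , p , 0≤t , Σt≈1 , p∈ , ≋-trans (≋-sym x≋y) x≋

  ⊙-closed : ∀ a (X : PointSet n) → Closed (a ⊙ X)
  ⊙-closed a X z≋z′ (x , x∈X , z≋) = x , x∈X , ≋-trans (≋-sym z≋z′) z≋

  ⊕-closed : (X Y : PointSet n) → Closed (X ⊕ Y)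
  ⊕-closed X Y z≋z′ (x , y , x∈X , y∈Y , z≋) = x , y , x∈X , y∈Y , ≋-trans (≋-sym z≋z′) z≋

  minkowskiSum-closed : ∀ {ℓ} {A : Set ℓ} (xs : List A) (X : A → PointSet n) → Closed (minkowskiSum xs X)
  minkowskiSum-closed []       X = λ x≋y x≋0 → ≋-trans (≋-sym x≋y) x≋0
  minkowskiSum-closed (x ∷ xs) X = ⊕-closed (X x) (minkowskiSum xs X)

  e∈simplex : ∀ {J : Subset n} {j} → j Subset.∈ J → e j ∈ simplex J
  e∈simplex {j = j} j∈J = 1 , (λ _ → 1#) , (λ _ → e j) , (λ _ → inj₁ 0<1) , +-identityʳ 1# ,
    (λ _ → j , j∈J , ≋-refl) , λ i → sym (trans (+-identityʳ _) (*-identityˡ _))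

  module _ {J : Subset n} {x : Point n} (x∈J : x ∈ simplex J) where

    private
      k = proj₁ x∈J
      t = proj₁ (proj₂ x∈J)
      p = proj₁ (proj₂ (proj₂ x∈J))
      0≤t : ∀ i → 0# ≤ᴿ t i
      0≤t = proj₁ (proj₂ (proj₂ (proj₂ x∈J)))
      Σt≈1 : sum t ≈ 1#
      Σt≈1 = proj₁ (proj₂ (proj₂ (proj₂ (proj₂ x∈J))))
      p∈ : ∀ i → ∃ λ j → j Subset.∈ J × p i ≋ e j
      p∈ = proj₁ (proj₂ (proj₂ (proj₂ (proj₂ (proj₂ x∈J)))))
      x≋ : x ≋ (λ j → sum (λ i → t i * p i j))
      x≋ = proj₂ (proj₂ (proj₂ (proj₂ (proj₂ (proj₂ x∈J)))))

    simplex-nonneg : ∀ i → 0# ≤ᴿ x i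
    simplex-nonneg i = ≤-resp refl (sym (x≋ i)) (sum-nonneg λ l →
      *-nonneg (0≤t l) (≤-resp refl (sym (proj₂ (proj₂ (p∈ l)) i)) (e-nonneg (proj₁ (p∈ l)) i)))

    simplex-support : ∀ {i} → i Subset.∉ J → x i ≈ 0#
    simplex-support {i} i∉J = trans (x≋ i) (sum-≈0 λ l →
      trans (*-congˡ (trans (proj₂ (proj₂ (p∈ l)) i)
              (e-off λ i≡j → i∉J (≡.subst (Subset._∈ J) (≡.sym i≡j) (proj₁ (proj₂ (p∈ l)))))))
            (zeroʳ (t l)))

    simplex-sum : sum x ≈ 1#
    simplex-sum = begin
      sum x                                   ≈⟨ sum-cong-≋ x≋ ⟩
      sum (λ j → sum (λ i → t i * p i j))     ≈⟨ ∑-comm (λ j i → t i * p i j) ⟩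
      sum (λ i → sum (λ j → t i * p i j))     ≈⟨ sum-cong-≋ (λ i → sym (*-distribˡ-sum (t i) (p i))) ⟩
      sum (λ i → t i * sum (p i))             ≈⟨ sum-cong-≋ (λ i → trans (*-congˡ (Σp≈1 i)) (*-identityʳ (t i))) ⟩
      sum t                                   ≈⟨ Σt≈1 ⟩
      1#                                      ∎
      where
      Σp≈1 : ∀ i → sum (p i) ≈ 1#
      Σp≈1 i = trans (sum-cong-≋ (proj₂ (proj₂ (p∈ i)))) (sum-e (proj₁ (p∈ i)))

    module _ (w : Word n) {i} (min : Minimizer (lookup w) J i) where

      private
        below : ∀ l → suc (lookup w i) · x l ≤ᴿ suc (lookup w l) · x l
        below l with l Subset.∈? J
        ... | yes l∈J = ·-monoˡ-≤ (s≤s (proj₂ min l∈J)) (simplex-nonneg l)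
        ... | no l∉J = inj₂ (trans (scaled (suc (lookup w i))) (sym (scaled (suc (lookup w l)))))
          where
          scaled : ∀ k → k · x l ≈ 0#
          scaled k = trans (×-congʳ k (simplex-support l∉J)) (·-zero k)

        Σbelow : sum (λ l → suc (lookup w i) · x l) ≈ ⟨ w , e i ⟩
        Σbelow = trans (·-distrib-sum (suc (lookup w i)) x)
          (trans (×-congʳ (suc (lookup w i)) simplex-sum) (sym (⟨,e⟩ w i)))

      -- Lowering every letter to the minimal one on J lowers the pairing term by term, as the
      -- coordinates of x are non-negative and supported on J. They sum to 1, so the lowered value
      -- is the one at `e i`.
      minimum≤ : ⟨ w , e i ⟩ ≤ᴿ ⟨ w , x ⟩
      minimum≤ = ≤-resp Σbelow refl (sum-mono-≤ below)

      minimum< : ∀ {l} → lookup w i ℕ.< lookup w l → 0# < x l → ⟨ w , e i ⟩ < ⟨ w , x ⟩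
      minimum< {l} wi<wl 0<xl = <-respˡ-≈ Σbelow (sum-mono-< below l (·-monoˡ-< (s≤s wi<wl) 0<xl))

      -- Positive weight on an element of J with a non-minimal letter would make the bound strict.
      attained⇒vanish : (∀ {j} → Minimizer (lookup w) J j → j ≡ i) → ⟨ w , x ⟩ ≤ᴿ ⟨ w , e i ⟩ →
                        ∀ {j} → j ≢ i → x j ≈ 0#
      attained⇒vanish uniq ⟨x⟩≤ {j} j≢i with j Subset.∈? J
      ... | no j∉J  = simplex-support j∉J
      ... | yes j∈J = 0≤∧≯0⇒≈0 (simplex-nonneg j) λ 0<xj → ≤⇒≯ ⟨x⟩≤ (minimum< wi<wj 0<xj)
        where
        wi<wj : lookup w i ℕ.< lookup w j
        wi<wj = ℕ.≤∧≢⇒< (proj₂ min j∈J) λ wi≡wj →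
          j≢i (uniq (j∈J , λ k∈J → ≡.subst (ℕ._≤ _) wi≡wj (proj₂ min k∈J)))

      attained⇒≋e : (∀ {j} → Minimizer (lookup w) J j → j ≡ i) → ⟨ w , x ⟩ ≤ᴿ ⟨ w , e i ⟩ → x ≋ e i
      attained⇒≋e uniq ⟨x⟩≤ l with l Fin.≟ i
      ... | no l≢i     = trans (attained⇒vanish uniq ⟨x⟩≤ l≢i) (sym (e-off l≢i))
      ... | yes ≡.refl = trans (sym (sum-single i (attained⇒vanish uniq ⟨x⟩≤))) (trans simplex-sum (sym (e-diag i)))

  -- Faces of Minkowski sums, and genericity

  infix 4 _≃_

  -- A wrapper: `≐` unfolds to a pair of inclusions, whereas the record keeps both point sets
  -- visible to unification.
  record _≃_ (X Y : PointSet n) : Set r where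
    constructor ≐⇒≃
    field
      ≃⇒≐ : X ≐ Y

  open _≃_

  face : PointSet n → Word n → PointSet n
  face X w x = x ∈ X × (∀ y → y ∈ X → ⟨ w , x ⟩ ≤ᴿ ⟨ w , y ⟩)

  -- `Generic q w` unfolds to `FaceIsPoint w (points q)`; stated for arbitrary point sets, the
  -- condition can be decomposed along Minkowski sums.
  FaceIsPoint : Word n → PointSet n → Set r
  FaceIsPoint w X = ∃ λ x → face X w ≐ (_≋ x)

  FaceIsPoint-resp : ∀ {w} {X Y : PointSet n} → X ≃ Y → FaceIsPoint w X → FaceIsPoint w Y
  FaceIsPoint-resp (≐⇒≃ (X⊆Y , Y⊆X)) (x , f , g) = x ,
    (λ (y∈Y , y≤) → f (Y⊆X y∈Y , λ z → y≤ z ∘ X⊆Y)) ,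
    (λ y≋x → let y∈X , y≤ = g y≋x in X⊆Y y∈X , λ z → y≤ z ∘ Y⊆X)

  module _ (w : Word n) {X Y : PointSet n} where

    face-⊕ : ∀ {x y z} → x ∈ face X w → y ∈ face Y w → z ≋ x +ₚ y → z ∈ face (X ⊕ Y) w
    face-⊕ {x} {y} (x∈X , x≤) (y∈Y , y≤) z≋ = (x , y , x∈X , y∈Y , z≋) ,
      λ { z′ (x′ , y′ , x′∈X , y′∈Y , z′≋) →
        ≤-resp (sym (trans (⟨,⟩-cong w z≋) (⟨,⟩-+ w x y))) (sym (trans (⟨,⟩-cong w z′≋) (⟨,⟩-+ w x′ y′)))
          (+-mono-≤ (x≤ x′ x′∈X) (y≤ y′ y′∈Y)) }

    face-⊕ˡ : ∀ {x y z} → z ∈ face (X ⊕ Y) w → x ∈ X → y ∈ Y → z ≋ x +ₚ y → x ∈ face X w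
    face-⊕ˡ {x} {y} (_ , z≤) x∈X y∈Y z≋ = x∈X , λ x′ x′∈X →
      +-cancelʳ-≤ ⟨ w , y ⟩ (≤-resp (trans (⟨,⟩-cong w z≋) (⟨,⟩-+ w x y)) (⟨,⟩-+ w x′ y)
        (z≤ (x′ +ₚ y) (x′ , y , x′∈X , y∈Y , ≋-refl)))

    face-⊕ʳ : ∀ {x y z} → z ∈ face (X ⊕ Y) w → x ∈ X → y ∈ Y → z ≋ x +ₚ y → y ∈ face Y w
    face-⊕ʳ {x} {y} (_ , z≤) x∈X y∈Y z≋ = y∈Y , λ y′ y′∈Y →
      +-cancelʳ-≤ ⟨ w , x ⟩ (≤-resp (trans (trans (⟨,⟩-cong w z≋) (⟨,⟩-+ w x y)) (+-comm _ _))
          (trans (⟨,⟩-+ w x y′) (+-comm _ _)) (z≤ (x +ₚ y′) (x , y′ , x∈X , y′∈Y , ≋-refl)))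

    -- The pairing is additive, so the face of a sum is the sum of the faces. Fixing a point of one
    -- face and cancelling it shows that the other face is a point.
    FaceIsPoint-⊕ : Closed X → Closed Y → FaceIsPoint w (X ⊕ Y) ⇔ (FaceIsPoint w X × FaceIsPoint w Y)
    FaceIsPoint-⊕ X-closed Y-closed = mk⇔ split join
      where
      split : FaceIsPoint w (X ⊕ Y) → FaceIsPoint w X × FaceIsPoint w Y
      split (z , f , g) with g ≋-refl
      ... | z∈ @ ((x , y , x∈X , y∈Y , z≋) , _) =
        (x , (λ {x′} x′∈ i → +-cancelʳ (y i) _ _ (trans (f (face-⊕ x′∈ y∈F ≋-refl) i) (z≋ i))) ,
             (λ x′≋x → X-closed (≋-sym x′≋x) x∈X , λ x″ x″∈X →
                ≤-resp (⟨,⟩-cong w (≋-sym x′≋x)) refl (proj₂ x∈F x″ x″∈X))) ,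
        (y , (λ {y′} y′∈ i → +-cancelˡ (x i) _ _ (trans (f (face-⊕ x∈F y′∈ ≋-refl) i) (z≋ i))) ,
             (λ y′≋y → Y-closed (≋-sym y′≋y) y∈Y , λ y″ y″∈Y →
                ≤-resp (⟨,⟩-cong w (≋-sym y′≋y)) refl (proj₂ y∈F y″ y″∈Y)))
        where
        open GroupProperties +-group using () renaming (∙-cancelˡ to +-cancelˡ; ∙-cancelʳ to +-cancelʳ)
        x∈F = face-⊕ˡ z∈ x∈X y∈Y z≋
        y∈F = face-⊕ʳ z∈ x∈X y∈Y z≋
      join : FaceIsPoint w X × FaceIsPoint w Y → FaceIsPoint w (X ⊕ Y)
      join ((x , f , g) , (y , f′ , g′)) = x +ₚ y ,
        (λ { z∈@((x′ , y′ , x′∈X , y′∈Y , z≋) , _) → ≋-trans z≋ λ i →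
             +-cong (f (face-⊕ˡ z∈ x′∈X y′∈Y z≋) i) (f′ (face-⊕ʳ z∈ x′∈X y′∈Y z≋) i) }) ,
        face-⊕ (g ≋-refl) (g′ ≋-refl)

  FaceIsPoint-0 : (w : Word n) → FaceIsPoint w (_≋ 0ₚ)
  FaceIsPoint-0 w = 0ₚ , proj₁ , λ x≋0 → x≋0 , λ y y≋0 →
    inj₂ (⟨,⟩-cong w (≋-trans x≋0 (≋-sym y≋0)))

  FaceIsPoint-minkowskiSum : ∀ {ℓ} {A : Set ℓ} (w : Word n) (xs : List A) (X : A → PointSet n) →
    (∀ a → Closed (X a)) →
    FaceIsPoint w (minkowskiSum xs X) ⇔ All (λ a → FaceIsPoint w (X a)) xs
  FaceIsPoint-minkowskiSum w [] X X-closed = mk⇔ (λ _ → []) (λ _ → FaceIsPoint-0 w)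
  FaceIsPoint-minkowskiSum w (a ∷ as) X X-closed =
    ⇔-trans (FaceIsPoint-⊕ w {X a} (X-closed a) (minkowskiSum-closed as X)) (mk⇔
      (λ (p , ps) → p ∷ to (FaceIsPoint-minkowskiSum w as X X-closed) ps)
      (λ { (p ∷ ps) → p , from (FaceIsPoint-minkowskiSum w as X X-closed) ps }))

  face-⊙simplex : ∀ {a} {J : Subset n} w {i} → 0# < a → Minimizer (lookup w) J i →
                  ∀ {z} → z ≋ a *ₚ e i → z ∈ face (a ⊙ simplex J) w
  face-⊙simplex {a = a} w {i} 0<a min {z} z≋ = (e i , e∈simplex (proj₁ min) , z≋) , λ { z′ (x , x∈J , z′≋) →
    ≤-resp (sym (trans (⟨,⟩-cong w z≋) (⟨,⟩-* w a (e i)))) (sym (trans (⟨,⟩-cong w z′≋) (⟨,⟩-* w a x)))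
      (*-monoˡ-≤ 0<a (minimum≤ x∈J w min)) }

  -- For a = 0 the dilate is the origin and imposes no condition. For a > 0, two minimizers i and k
  -- would put both vertices a e_i and a e_k on the face; comparing their coordinates at k forces a
  -- = 0.
  FaceIsPoint-⊙simplex : ∀ {a} {J : Subset n} w → 0# ≤ᴿ a → Nonempty J →
                         FaceIsPoint w (a ⊙ simplex J) ⇔ (0# < a → UniqueMinimizer (lookup w) J)
  FaceIsPoint-⊙simplex {a = a} {J} w 0≤a (j , j∈J) = mk⇔ f g
    where
    f : FaceIsPoint w (a ⊙ simplex J) → 0# < a → UniqueMinimizer (lookup w) J
    f (x , F⊆ , _) 0<a with minimizer-exists (lookup w) J (j , j∈J)
    ... | i , min = i , min , uniq
      where
      uniq : ∀ {k} → Minimizer (lookup w) J k → k ≡ i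
      uniq {k} min′ with k Fin.≟ i
      ... | yes k≡i = k≡i
      ... | no k≢i = contradiction 0<a (<-irrefl (sym a≈0))
        where
        aek≋aei : a *ₚ e k ≋ a *ₚ e i
        aek≋aei = ≋-trans (F⊆ (face-⊙simplex w 0<a min′ ≋-refl)) (≋-sym (F⊆ (face-⊙simplex w 0<a min ≋-refl)))
        a≈0 : a ≈ 0#
        a≈0 = begin
          a            ≈⟨ *-identityʳ a ⟨
          a * 1#       ≈⟨ *-congˡ (e-diag k) ⟨
          a * e k k    ≈⟨ aek≋aei k ⟩
          a * e i k    ≈⟨ *-congˡ (e-off k≢i) ⟩
          a * 0#       ≈⟨ zeroʳ a ⟩
          0#           ∎
    g : (0# < a → UniqueMinimizer (lookup w) J) → FaceIsPoint w (a ⊙ simplex J)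
    g unique with 0<? a
    ... | yes 0<a with unique 0<a
    ...   | i , min , uniq = a *ₚ e i ,
      (λ { {z} ((x , x∈J , z≋) , z≤) → ≋-trans z≋ λ l → *-congˡ (attained⇒≋e x∈J w min uniq
         (*-cancelˡ-≤ 0<a (≤-resp (trans (⟨,⟩-cong w z≋) (⟨,⟩-* w a x)) (⟨,⟩-* w a (e i))
            (z≤ (a *ₚ e i) (e i , e∈simplex (proj₁ min) , ≋-refl)))) l) }) ,
      face-⊙simplex w 0<a min
    g unique | no 0≮a = 0ₚ , (λ ((x , _ , z≋) , _) → ≋-trans z≋ (a*x≋0 x)) ,
      λ z≋0 → (e j , e∈simplex j∈J , ≋-trans z≋0 (≋-sym (a*x≋0 (e j)))) , λ { z′ (x , _ , z′≋) →
        inj₂ (⟨,⟩-cong w (≋-trans z≋0 (≋-sym (≋-trans z′≋ (a*x≋0 x))))) }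
      where
      a*x≋0 : ∀ x → a *ₚ x ≋ 0ₚ
      a*x≋0 x i = trans (*-congʳ (0≤∧≯0⇒≈0 0≤a 0≮a)) (zeroˡ (x i))

  -- The face splits over all non-empty J, and only those with positive coefficient contribute a
  -- condition.
  generic⇔ : (q : HypergraphicPolytope n) (w : Word n) →
             w ∈ Generic q ⇔ (∀ {J} → J ∈ 𝓕 q → composition w ∈ Orth J)
  generic⇔ {n} q w = ⇔-trans
    (FaceIsPoint-minkowskiSum w (nonemptySubsets n) (λ J → coeff q J ⊙ simplex J) (λ J → ⊙-closed _ (simplex J)))
    (mk⇔ (λ all {J} (J≠∅ , 0<a) → from (orth⇔uniqueMinimizer J w)
            (to (FaceIsPoint-⊙simplex w (coeff≥0 J J≠∅) J≠∅) (All.lookup all (∈-nonemptySubsets J≠∅)) 0<a))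
         (λ orth → All.map (λ {J} J≠∅ → from (FaceIsPoint-⊙simplex w (coeff≥0 J J≠∅) J≠∅)
            λ 0<a → to (orth⇔uniqueMinimizer J w) (orth (J≠∅ , 0<a))) (nonemptySubsets-nonempty n)))
    where open HypergraphicPolytope q using (coeff≥0)

  -- Algebra of Minkowski sums, and the polytope of a family

  ≃-refl : {X : PointSet n} → X ≃ X
  ≃-refl = ≐⇒≃ (id , id)

  ≃-sym : {X Y : PointSet n} → X ≃ Y → Y ≃ X
  ≃-sym (≐⇒≃ (f , g)) = ≐⇒≃ (g , f)

  ≃-trans : {X Y Z : PointSet n} → X ≃ Y → Y ≃ Z → X ≃ Z
  ≃-trans (≐⇒≃ (f , g)) (≐⇒≃ (f′ , g′)) = ≐⇒≃ (f′ ∘ f , g ∘ g′)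

  ⊕-cong : {X X′ Y Y′ : PointSet n} → X ≃ X′ → Y ≃ Y′ → (X ⊕ Y) ≃ (X′ ⊕ Y′)
  ⊕-cong (≐⇒≃ (f , g)) (≐⇒≃ (f′ , g′)) = ≐⇒≃ $ (λ (x , y , x∈ , y∈ , z≋) → x , y , f x∈ , f′ y∈ , z≋) ,
                             (λ (x , y , x∈ , y∈ , z≋) → x , y , g x∈ , g′ y∈ , z≋)

  ⊕-identityˡ : {X : PointSet n} → Closed X → ((_≋ 0ₚ) ⊕ X) ≃ X
  ⊕-identityˡ X-closed = ≐⇒≃ $
    (λ (x , y , x≋0 , y∈ , z≋) → X-closed (≋-sym (≋-trans z≋ λ i → trans (+-congʳ (x≋0 i)) (+-identityˡ (y i)))) y∈) ,
    (λ {z} z∈ → 0ₚ , z , ≋-refl , z∈ , λ i → sym (+-identityˡ (z i)))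

  ⊕-assoc : {X Y Z : PointSet n} → ((X ⊕ Y) ⊕ Z) ≃ (X ⊕ (Y ⊕ Z))
  ⊕-assoc = ≐⇒≃ $
    (λ (_ , z , (x , y , x∈ , y∈ , s≋) , z∈ , t≋) → x , y +ₚ z , x∈ , (y , z , y∈ , z∈ , ≋-refl) ,
       ≋-trans t≋ λ i → trans (+-congʳ (s≋ i)) (+-assoc (x i) (y i) (z i))) ,
    (λ (x , _ , x∈ , (y , z , y∈ , z∈ , s≋) , t≋) → x +ₚ y , z , (x , y , x∈ , y∈ , ≋-refl) , z∈ ,
       ≋-trans t≋ λ i → trans (+-congˡ (s≋ i)) (sym (+-assoc (x i) (y i) (z i))))

  ⊕-comm : {X Y : PointSet n} → (X ⊕ Y) ≃ (Y ⊕ X)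
  ⊕-comm = ≐⇒≃ $ (λ (x , y , x∈ , y∈ , z≋) → y , x , y∈ , x∈ , ≋-trans z≋ λ i → +-comm (x i) (y i)) ,
           (λ (x , y , x∈ , y∈ , z≋) → y , x , y∈ , x∈ , ≋-trans z≋ λ i → +-comm (x i) (y i))

  module _ {ℓ} {A : Set ℓ} (X : A → PointSet n) where

    minkowskiSum-++ : ∀ xs ys → minkowskiSum (xs ++ ys) X ≃ (minkowskiSum xs X ⊕ minkowskiSum ys X)
    minkowskiSum-++ []       ys = ≃-sym (⊕-identityˡ {X = minkowskiSum ys X} (minkowskiSum-closed ys X))
    minkowskiSum-++ (x ∷ xs) ys = ≃-trans (⊕-cong (≃-refl {X = X x}) (minkowskiSum-++ xs ys))
                                           (≃-sym (⊕-assoc {X = X x}))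

    minkowskiSum-↭ : ∀ {xs ys} → xs ↭ ys → minkowskiSum xs X ≃ minkowskiSum ys X
    minkowskiSum-↭ ↭.refl          = ≃-refl
    minkowskiSum-↭ (↭.prep x p)    = ⊕-cong (≃-refl {X = X x}) (minkowskiSum-↭ p)
    minkowskiSum-↭ (↭.swap x y p)  =
      ≃-trans (⊕-cong (≃-refl {X = X x}) (⊕-cong (≃-refl {X = X y}) (minkowskiSum-↭ p)))
      (≃-trans (≃-sym (⊕-assoc {X = X x} {X y}))
      (≃-trans (⊕-cong (⊕-comm {X = X x} {X y}) ≃-refl) (⊕-assoc {X = X y} {X x})))
    minkowskiSum-↭ (↭.trans p p′)  = ≃-trans (minkowskiSum-↭ p) (minkowskiSum-↭ p′)

  1⊙ : {X : PointSet n} → Closed X → (1# ⊙ X) ≃ X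
  1⊙ X-closed = ≐⇒≃ $ (λ (x , x∈ , z≋) → X-closed (≋-sym (≋-trans z≋ λ i → *-identityˡ (x i))) x∈) ,
                (λ {x} x∈ → x , x∈ , λ i → sym (*-identityˡ (x i)))

  0⊙ : {X : PointSet n} → ∃ X → (0# ⊙ X) ≃ (_≋ 0ₚ)
  0⊙ (x , x∈) = ≐⇒≃ $ (λ (y , _ , z≋) → ≋-trans z≋ λ i → zeroˡ (y i)) ,
                (λ z≋0 → x , x∈ , ≋-trans z≋0 λ i → sym (zeroˡ (x i)))

  _∈?_ : (J : Subset n) (𝒜 : List (Subset n)) → Dec (J List.∈ 𝒜)
  _∈?_ = DecMembership._∈?_ _≟ˢ_

  -- The chosen representative modulo simple relations. It depends only on which sets occur in the
  -- list, so families can be permuted and enlarged by repetitions freely.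
  fromFamily : List (Subset n) → HypergraphicPolytope n
  fromFamily 𝒜 = record
    { coeff   = λ J → if does (J ∈? 𝒜) then 1# else 0#
    ; coeff≥0 = λ J _ → nonneg J
    }
    where
    nonneg : ∀ J → 0# ≤ᴿ (if does (J ∈? 𝒜) then 1# else 0#)
    nonneg J with does (J ∈? 𝒜)
    ... | true  = inj₁ 0<1
    ... | false = ≤-refl

  𝓕-fromFamily : ∀ {𝒜} {J : Subset n} → J ∈ 𝓕 (fromFamily 𝒜) ⇔ (Nonempty J × J List.∈ 𝒜)
  𝓕-fromFamily {𝒜 = 𝒜} {J} with J ∈? 𝒜
  ... | yes J∈ = mk⇔ (λ (J≠∅ , _) → J≠∅ , J∈) (λ (J≠∅ , _) → J≠∅ , 0<1)
  ... | no J∉ = mk⇔ (λ (_ , 0<0) → contradiction 0<0 (<-irrefl refl)) (λ (_ , J∈) → contradiction J∈ J∉)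

  -- A simplex on a non-empty set is inhabited, so dilating it by 0 gives the neutral summand. What
  -- remains is a sum over a filtered enumeration with the same members as 𝒜, and for lists without
  -- repetitions this means a permutation.
  points-fromFamily : {𝒜 : List (Subset n)} → All Nonempty 𝒜 → Unique 𝒜 → points (fromFamily 𝒜) ≃ 𝓕⁻¹ 𝒜
  points-fromFamily {n} {𝒜} 𝒜≠∅ 𝒜! = ≃-trans (selected (nonemptySubsets-nonempty n))
    (minkowskiSum-↭ simplex (∼bag⇒↭ (List.unique∧set⇒bag
      (Unique.filter⁺ (_∈? 𝒜) (nonemptySubsets-unique n)) 𝒜!
      (mk⇔ (λ J∈ → proj₂ (List.∈-filter⁻ (_∈? 𝒜) {xs = nonemptySubsets n} J∈))
           (λ J∈ → List.∈-filter⁺ (_∈? 𝒜) (∈-nonemptySubsets (All.lookup 𝒜≠∅ J∈)) J∈)))))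
    where
    selected : ∀ {Js} → All Nonempty Js →
      minkowskiSum Js (λ J → coeff (fromFamily 𝒜) J ⊙ simplex J) ≃ 𝓕⁻¹ (List.filter (_∈? 𝒜) Js)
    selected [] = ≃-refl
    selected {J ∷ Js} ((j , j∈J) ∷ Js≠∅) with does (J ∈? 𝒜)
    ... | true  = ⊕-cong (1⊙ (simplex-closed J)) (selected Js≠∅)
    ... | false = ≃-trans (⊕-cong (0⊙ (_ , e∈simplex j∈J)) (selected Js≠∅))
                          (⊕-identityˡ {X = 𝓕⁻¹ (List.filter (_∈? 𝒜) Js)}
                            (minkowskiSum-closed (List.filter (_∈? 𝒜) Js) simplex))

  points-fromFamily-cong : {𝒜 ℬ : List (Subset n)} → (∀ {J} → J List.∈ 𝒜 ⇔ J List.∈ ℬ) →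
                           points (fromFamily 𝒜) ≃ points (fromFamily ℬ)
  points-fromFamily-cong {n} {𝒜} {ℬ} 𝒜⇔ℬ = sound (List.map-cong (λ J →
    ≡.cong (λ b → (if b then 1# else 0#) ⊙ simplex J) (does-⇔ (𝒜⇔ℬ {J}) (J ∈? 𝒜) (J ∈? ℬ))) (nonemptySubsets n))
    where
    sound : ∀ {Xs Ys : List (PointSet n)} → Xs ≡ Ys → List.foldr _⊕_ (_≋ 0ₚ) Xs ≃ List.foldr _⊕_ (_≋ 0ₚ) Ys
    sound ≡.refl = ≃-refl

-- Separation of lists, and alternating sums over sublists

Separates : ∀ {a p} {A : Set a} → Pred A p → List A → List A → Set _
Separates P xs ys = All P xs × All (∁ P) ys

-- The complementary case in witness form. For membership of π in Orth it is literally the covering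
-- condition of `ModularRelation` at π.
FailsToSeparate : ∀ {a p} {A : Set a} → Pred A p → List A → List A → Set _
FailsToSeparate P xs ys = Any (∁ P) xs ⊎ Any P ys

separates? : ∀ {a p} {A : Set a} {P : Pred A p} → Decidable P →
             ∀ xs ys → Separates P xs ys ⊎ FailsToSeparate P xs ys
separates? P? xs ys with All.decide (toSum ∘ P?) xs | All.search P? ys
... | inj₁ all | inj₁ none = inj₁ (all , none)
... | inj₁ all | inj₂ any  = inj₂ (inj₂ any)
... | inj₂ any | _         = inj₂ (inj₁ any)

module Alternating {c ℓ m ℓm} {R : Ring c ℓ} (V : LeftModule R m ℓm) where

  open Ring R
  open LeftModule V
  open Exponentiation semiring using (_^_)
  open RingProperties R using (-1*x≈-x; -0#≈0#)

  private
    variable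
      a : Level
      A : Set a

  ∑-++ : ∀ (xs ys : List A) g → ∑ᴹ V (xs ++ ys) g ≈ᴹ ∑ᴹ V xs g +ᴹ ∑ᴹ V ys g
  ∑-++ []       ys g = ≈ᴹ-sym (+ᴹ-identityˡ _)
  ∑-++ (x ∷ xs) ys g = ≈ᴹ-trans (+ᴹ-congˡ (∑-++ xs ys g)) (≈ᴹ-sym (+ᴹ-assoc _ _ _))

  ∑-map : ∀ {b} {B : Set b} (f : A → B) (xs : List A) g → ∑ᴹ V (List.map f xs) g ≈ᴹ ∑ᴹ V xs (g ∘ f)
  ∑-map f []       g = ≈ᴹ-refl
  ∑-map f (x ∷ xs) g = +ᴹ-congˡ (∑-map f xs g)

  ∑-cong : ∀ (xs : List A) {g h} → (∀ {x} → x List.∈ xs → g x ≈ᴹ h x) → ∑ᴹ V xs g ≈ᴹ ∑ᴹ V xs h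
  ∑-cong []     g≈h = ≈ᴹ-refl
  ∑-cong (x ∷ xs) g≈h = +ᴹ-cong (g≈h (here ≡.refl)) (∑-cong xs (g≈h ∘ there))

  ∑-*ₗ : ∀ k (xs : List A) g → ∑ᴹ V xs (λ x → k *ₗ g x) ≈ᴹ k *ₗ ∑ᴹ V xs g
  ∑-*ₗ k []       g = ≈ᴹ-sym (*ₗ-zeroʳ k)
  ∑-*ₗ k (x ∷ xs) g = ≈ᴹ-trans (+ᴹ-congˡ (∑-*ₗ k xs g)) (≈ᴹ-sym (*ₗ-distribˡ k _ _))

  -- The signed sum over sublists as an iterated difference, one per element; cancellation then
  -- becomes an induction on the list.
  alternate : (List A → Carrierᴹ) → List A → Carrierᴹ
  alternate g []       = g []
  alternate g (x ∷ xs) = alternate g xs +ᴹ (- 1#) *ₗ alternate (g ∘ (x ∷_)) xs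

  alternate-cong : ∀ {g h : List A → Carrierᴹ} → (∀ T → g T ≈ᴹ h T) → ∀ xs → alternate g xs ≈ᴹ alternate h xs
  alternate-cong g≈h []       = g≈h []
  alternate-cong g≈h (x ∷ xs) =
    +ᴹ-cong (alternate-cong g≈h xs) (*ₗ-congˡ (alternate-cong (g≈h ∘ (x ∷_)) xs))

  ∑-sublists : ∀ (g : List A → Carrierᴹ) xs →
               ∑ᴹ V (sublists xs) (λ T → (- 1#) ^ length T *ₗ g T) ≈ᴹ alternate g xs
  ∑-sublists g []       = ≈ᴹ-trans (+ᴹ-identityʳ _) (*ₗ-identityˡ _)
  ∑-sublists g (x ∷ xs) = begin
    ∑ᴹ V (sublists xs ++ List.map (x ∷_) (sublists xs)) (signed g)
      ≈⟨ ∑-++ (sublists xs) _ (signed g) ⟩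
    ∑ᴹ V (sublists xs) (signed g) +ᴹ ∑ᴹ V (List.map (x ∷_) (sublists xs)) (signed g)
      ≈⟨ +ᴹ-cong (∑-sublists g xs) (∑-map (x ∷_) (sublists xs) (signed g)) ⟩
    alternate g xs +ᴹ ∑ᴹ V (sublists xs) (signed g ∘ (x ∷_))
      ≈⟨ +ᴹ-congˡ (∑-cong (sublists xs) (λ _ → *ₗ-assoc _ _ _)) ⟩
    alternate g xs +ᴹ ∑ᴹ V (sublists xs) (λ T → (- 1#) *ₗ signed (g ∘ (x ∷_)) T)
      ≈⟨ +ᴹ-congˡ (≈ᴹ-trans (∑-*ₗ (- 1#) (sublists xs) _) (*ₗ-congˡ (∑-sublists (g ∘ (x ∷_)) xs))) ⟩
    alternate g xs +ᴹ (- 1#) *ₗ alternate (g ∘ (x ∷_)) xs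
      ∎
    where
    open SetoidReasoning ≈ᴹ-setoid
    signed : (List _ → Carrierᴹ) → List _ → Carrierᴹ
    signed g T = (- 1#) ^ length T *ₗ g T

  -- In the application φ evaluates Υ at one fixed word.
  module Functional (φ : Carrierᴹ → Carrier)
    (φ-+ : ∀ x y → φ (x +ᴹ y) ≈ φ x + φ y) (φ-* : ∀ k x → φ (k *ₗ x) ≈ k * φ x) where

    φ-alternate-∷ : ∀ (g : List A → Carrierᴹ) x xs →
                    φ (alternate g (x ∷ xs)) ≈ φ (alternate g xs) - φ (alternate (g ∘ (x ∷_)) xs)
    φ-alternate-∷ g x xs = trans (φ-+ _ _) (+-congˡ (trans (φ-* _ _) (-1*x≈-x _)))

    alternate-cong-φ : ∀ {g h : List A → Carrierᴹ} → (∀ T → φ (g T) ≈ φ (h T)) →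
                       ∀ xs → φ (alternate g xs) ≈ φ (alternate h xs)
    alternate-cong-φ g≈h []       = g≈h []
    alternate-cong-φ {g = g} {h} g≈h (x ∷ xs) = trans (φ-alternate-∷ g x xs) (trans
      (+-cong (alternate-cong-φ g≈h xs) (-‿cong (alternate-cong-φ (g≈h ∘ (x ∷_)) xs)))
      (sym (φ-alternate-∷ h x xs)))

    alternate-zero : ∀ {g : List A → Carrierᴹ} → (∀ T → φ (g T) ≈ 0#) → ∀ xs → φ (alternate g xs) ≈ 0#
    alternate-zero g≈0 []       = g≈0 []
    alternate-zero {g = g} g≈0 (x ∷ xs) = trans (φ-alternate-∷ g x xs)
      (trans (+-cong (alternate-zero g≈0 xs) (-‿cong (alternate-zero (g≈0 ∘ (x ∷_)) xs))) (-‿inverseʳ 0#))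

    module _ {p} {P : Pred A p} (P? : Decidable P) {v : Carrier} where

      private
        IsIndicator : (List A → Carrierᴹ) → Set _
        IsIndicator g = (∀ {T} → All P T → φ (g T) ≈ v) × (∀ {T} → Any (∁ P) T → φ (g T) ≈ 0#)

        indicator-∷ : ∀ {g x} → IsIndicator g → P x → ∀ T → φ (g T) ≈ φ (g (x ∷ T))
        indicator-∷ (g-all , g-any) Px T with All.decide (toSum ∘ P?) T
        ... | inj₁ all = trans (g-all all) (sym (g-all (Px ∷ all)))
        ... | inj₂ any = trans (g-any any) (sym (g-any (there any)))

        ∷-indicator : ∀ {g x} → IsIndicator g → P x → IsIndicator (g ∘ (x ∷_))
        ∷-indicator (g-all , g-any) Px = (λ all → g-all (Px ∷ all)) , (λ any → g-any (there any))

        alternate-∁ : ∀ {g x} → IsIndicator g → ¬ P x → ∀ xs → φ (alternate g (x ∷ xs)) ≈ φ (alternate g xs)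
        alternate-∁ {g} {x} (_ , g-any) ¬Px xs = trans (φ-alternate-∷ g x xs)
          (trans (+-congˡ (trans (-‿cong (alternate-zero (λ T → g-any (here ¬Px)) xs)) -0#≈0#)) (+-identityʳ _))

      alternate-none : ∀ {g} → IsIndicator g → ∀ {xs} → All (∁ P) xs → φ (alternate g xs) ≈ v
      alternate-none ind [] = proj₁ ind []
      alternate-none ind {x ∷ xs} (¬Px ∷ none) = trans (alternate-∁ ind ¬Px xs) (alternate-none ind none)

      -- Inserting or deleting an element satisfying P leaves the value of g unchanged and flips the
      -- sign, so the sublists cancel in pairs.
      alternate-any : ∀ {g} → IsIndicator g → ∀ {xs} → Any P xs → φ (alternate g xs) ≈ 0#
      alternate-any {g} ind {x ∷ xs} (here Px) = trans (φ-alternate-∷ g x xs)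
        (trans (+-congʳ (alternate-cong-φ (indicator-∷ ind Px) xs)) (-‿inverseʳ _))
      alternate-any {g} ind {x ∷ xs} (there any) with P? x
      ... | no ¬Px = trans (alternate-∁ ind ¬Px xs) (alternate-any ind any)
      ... | yes Px = trans (φ-alternate-∷ g x xs) (trans
        (+-cong (alternate-any ind any) (-‿cong (alternate-any (∷-indicator ind Px) any))) (-‿inverseʳ 0#))

-- Sums of monomials over set compositions, and SC inside WQSym

module Quasisymmetric {c ℓ₁ ℓ₂} (K : HeytingField c ℓ₁ ℓ₂) where

  open CommutativeRing (fieldCommutativeRing K) hiding (zero)
  open WordSymmetric K

  M-diagonal : (π : SetComposition n) (w : Word n) →
               (wordBlocks w ≡ blocks π → M π n w ≈ 1#) × (wordBlocks w ≢ blocks π → M π n w ≈ 0#)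
  M-diagonal {n} π w with n ℕ.≟ n
  ... | no n≢n = contradiction ≡.refl n≢n
  ... | yes ≡.refl with List.≡-dec _≟ˢ_ (wordBlocks w) (blocks π)
  ...   | yes eq = (λ _ → refl) , (λ neq → contradiction eq neq)
  ...   | no neq = (λ eq → contradiction eq neq) , (λ _ → refl)

  M-otherDegree : ∀ {m} (π : SetComposition n) (w : Word m) → m ≢ n → M π m w ≈ 0#
  M-otherDegree {n} {m} π w m≢n with m ℕ.≟ n
  ... | yes m≡n = contradiction m≡n m≢n
  ... | no _ = refl

  module _ (w : Word n) where

    ∑M-none : ∀ {πs} → All (λ π → wordBlocks w ≢ blocks π) πs → ∑ᴹ series πs M n w ≈ 0#
    ∑M-none []                    = refl
    ∑M-none {π ∷ _} (neq ∷ none) = trans (+-cong (proj₂ (M-diagonal π w) neq) (∑M-none none)) (+-identityˡ 0#)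

    ∑M-one : ∀ {πs} → AllPairs (λ π τ → blocks π ≢ blocks τ) πs → Any (λ π → wordBlocks w ≡ blocks π) πs →
             ∑ᴹ series πs M n w ≈ 1#
    ∑M-one {π ∷ _} (π≢ ∷ _) (here eq) = trans
      (+-cong (proj₁ (M-diagonal π w) eq) (∑M-none (All.map (λ neq eq′ → neq (≡.trans (≡.sym eq) eq′)) π≢)))
      (+-identityʳ 1#)
    ∑M-one {π ∷ πs} (π≢ ∷ unique) (there any) = trans
      (+-cong (proj₂ (M-diagonal π w) λ eq →
              All.All¬⇒¬Any (All.map (λ neq eq′ → neq (≡.trans (≡.sym eq) eq′)) π≢) any)
              (∑M-one unique any))
      (+-identityˡ 1#)

  ∑M-otherDegree : ∀ {m} (πs : List (SetComposition n)) (w : Word m) → m ≢ n → ∑ᴹ series πs M m w ≈ 0#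
  ∑M-otherDegree []       w m≢n = refl
  ∑M-otherDegree (π ∷ πs) w m≢n =
    trans (+-cong (M-otherDegree π w m≢n) (∑M-otherDegree πs w m≢n)) (+-identityˡ 0#)

  module _ {p} {Q : Pred (SetComposition n) p} (Q? : Decidable Q)
    (Q-resp : ∀ π τ → blocks π ≡ blocks τ → Q π → Q τ) (w : Word n) where

    -- The block list of w occurs exactly once in the enumeration, so exactly one M contributes 1.
    ∑M-inside : Q (composition w) → ∑ᴹ series (List.filter Q? (setCompositions n)) M n w ≈ 1#
    ∑M-inside Qw with τ , τ∈ , eq ← setCompositions-complete (composition w) =
      ∑M-one w (AllPairs.filter⁺ Q? (setCompositions-unique n))
        (List.lose (List.∈-filter⁺ Q? τ∈ (Q-resp _ τ eq Qw)) eq)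

    ∑M-outside : ¬ Q (composition w) → ∑ᴹ series (List.filter Q? (setCompositions n)) M n w ≈ 0#
    ∑M-outside ¬Qw = ∑M-none w (All.map (λ {π} Qπ eq → ¬Qw (Q-resp π _ (≡.sym eq) Qπ))
      (All.all-filter Q? (setCompositions n)))

  ∑M∈WQSym : (πs : List (SetComposition n)) → ∑ᴹ series πs M ∈ WQSym
  ∑M∈WQSym []       = zero
  ∑M∈WQSym (π ∷ πs) = add (gen (_ , π , ≡.refl)) (∑M∈WQSym πs)

  ∼-resp : ∀ (π σ τ : SetComposition n) → blocks σ ≡ blocks τ → σ ∼ π → τ ∼ π
  ∼-resp π σ τ eq σ∼π A A≠∅ =
    ⇔-trans (mk⇔ (orth-blocks A {τ} {σ} (≡.sym eq)) (orth-blocks A {σ} {τ} eq)) (σ∼π A A≠∅)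

  N-inside : (π : SetComposition n) (w : Word n) → composition w ∼ π → N π n w ≈ 1#
  N-inside π = ∑M-inside (_∼? π) (∼-resp π)

  N-outside : (π : SetComposition n) (w : Word n) → ¬ composition w ∼ π → N π n w ≈ 0#
  N-outside π = ∑M-outside (_∼? π) (∼-resp π)

  N-otherDegree : ∀ {m} (π : SetComposition n) (w : Word m) → m ≢ n → N π m w ≈ 0#
  N-otherDegree {n} π = ∑M-otherDegree (List.filter (_∼? π) (setCompositions n))

  SC⊆WQSym : SC ⊆ WQSym
  SC⊆WQSym (gen (n , π , ≡.refl)) = ∑M∈WQSym (List.filter (_∼? π) (setCompositions n))
  SC⊆WQSym zero                   = zero
  SC⊆WQSym (add F∈ G∈)            = add (SC⊆WQSym F∈) (SC⊆WQSym G∈)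
  SC⊆WQSym (scale a F∈)           = scale a (SC⊆WQSym F∈)
  SC⊆WQSym (resp F≈G F∈)          = resp F≈G (SC⊆WQSym F∈)

  -- Each N is the indicator of an equivalence class, and span operations preserve constancy on
  -- classes. This is the invariant that detects series outside SC.
  SC-invariant : ∀ (v w : Word n) → composition v ∼ composition w → ∀ {F} → F ∈ SC → F n v ≈ F n w
  SC-invariant {n} v w v∼w (gen (k , π , ≡.refl)) with n ℕ.≟ k
  ... | no n≢k = trans (N-otherDegree π v n≢k) (sym (N-otherDegree π w n≢k))
  ... | yes ≡.refl with composition w ∼? π
  ...   | yes w∼π = trans (N-inside π v (λ A A≠∅ → ⇔-trans (v∼w A A≠∅) (w∼π A A≠∅))) (sym (N-inside π w w∼π))
  ...   | no w≁π = trans (N-outside π v (λ v∼π → w≁π λ A A≠∅ → ⇔-trans (⇔-sym (v∼w A A≠∅)) (v∼π A A≠∅)))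
                         (sym (N-outside π w w≁π))
  SC-invariant v w v∼w zero           = refl
  SC-invariant v w v∼w (add F∈ G∈)    = +-cong (SC-invariant v w v∼w F∈) (SC-invariant v w v∼w G∈)
  SC-invariant v w v∼w (scale a F∈)   = *-congˡ (SC-invariant v w v∼w F∈)
  SC-invariant {n} v w v∼w (resp F≈G F∈) = trans (sym (F≈G n v)) (trans (SC-invariant v w v∼w F∈) (F≈G n w))

  -- The set compositions 1|2 and 2|1 are equivalent, so the coefficients of
  -- a series in SC at a₁a₂ and a₂a₁ agree; those of M_{1|2} do not.
  WQSym⊈SC : CharacteristicZero K → ¬ WQSym ⊆ SC
  WQSym⊈SC char0 WQSym⊆SC = char0 0 (trans (+-identityʳ 1#) 1≈0)
    where
    v w : Word 2
    v = 0 ∷ 1 ∷ []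
    w = 1 ∷ 0 ∷ []
    1≈0 : 1# ≈ 0#
    1≈0 = SC-invariant v w (from-yes (composition v ∼? composition w))
      (WQSym⊆SC (gen (2 , composition v , ≡.refl)))

-- Sublists, and partitions of the non-empty subsets

Unique-resp-⊇ : ∀ {a} {A : Set a} {xs ys : List A} → ys Sublist.⊆ xs → Unique xs → Unique ys
Unique-resp-⊇ Sublist.[]          []       = []
Unique-resp-⊇ (x Sublist.∷ʳ p)    (_ ∷ u)  = Unique-resp-⊇ p u
Unique-resp-⊇ (≡.refl Sublist.∷ p) (x∉ ∷ u) = Sublist.All-resp-⊆ p x∉ ∷ Unique-resp-⊇ p u

∈-sublists⇒⊆ : ∀ {a} {A : Set a} (xs : List A) {ys} → ys List.∈ sublists xs → ys Sublist.⊆ xs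
∈-sublists⇒⊆ []       (here ≡.refl) = Sublist.[]
∈-sublists⇒⊆ (x ∷ xs) ys∈ with List.∈-++⁻ (sublists xs) ys∈
... | inj₁ ys∈ˡ = x Sublist.∷ʳ ∈-sublists⇒⊆ xs ys∈ˡ
... | inj₂ ys∈ʳ with zs , zs∈ , ≡.refl ← List.∈-map⁻ (x ∷_) ys∈ʳ = ≡.refl Sublist.∷ ∈-sublists⇒⊆ xs zs∈

Unique-++⁻ : ∀ {a} {A : Set a} (xs : List A) {ys} → Unique (xs ++ ys) → Unique xs × Unique ys × Disjoint xs ys
Unique-++⁻ []       u = [] , u , λ ()
Unique-++⁻ (x ∷ xs) {ys} (x∉ ∷ u) with u-xs , u-ys , xs#ys ← Unique-++⁻ xs u =
  All.++⁻ˡ xs x∉ ∷ u-xs , u-ys , disjoint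
  where
  disjoint : Disjoint (x ∷ xs) ys
  disjoint (here ≡.refl , x∈ys) = All.lookup (All.++⁻ʳ xs x∉) x∈ys ≡.refl
  disjoint (there x∈xs , x∈ys)  = xs#ys (x∈xs , x∈ys)

-- The state at a node of the splitting: 𝒜 chosen, ℬ rejected, 𝒞 undecided. A single permutation
-- yields non-emptiness, absence of repetitions, disjointness and completeness together.
record Partition (𝒜 ℬ 𝒞 : List (Subset n)) : Set where
  constructor partition
  field
    ↭-nonemptySubsets : 𝒞 ++ 𝒜 ++ ℬ ↭ nonemptySubsets n

  private
    all≠∅ : All Nonempty (𝒞 ++ 𝒜 ++ ℬ)
    all≠∅ = ↭.All-resp-↭ (↭-sym ↭-nonemptySubsets) (nonemptySubsets-nonempty n)

  𝒜≠∅ : All Nonempty 𝒜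
  𝒜≠∅ = All.++⁻ˡ 𝒜 (All.++⁻ʳ 𝒞 all≠∅)

  ℬ≠∅ : All Nonempty ℬ
  ℬ≠∅ = All.++⁻ʳ 𝒜 (All.++⁻ʳ 𝒞 all≠∅)

  𝒞≠∅ : All Nonempty 𝒞
  𝒞≠∅ = All.++⁻ˡ 𝒞 all≠∅

  unique : Unique (𝒞 ++ 𝒜 ++ ℬ)
  unique = ↭ₛ.Unique-resp-↭ (≡.setoid _) (↭⇒↭ₛ (↭-sym ↭-nonemptySubsets)) (nonemptySubsets-unique n)

open Partition

trivialPartition : ∀ n → Partition [] [] (nonemptySubsets n)
trivialPartition n = partition (↭-reflexive (List.++-identityʳ _))

partition-complete : ∀ {𝒜 ℬ : List (Subset n)} → Partition 𝒜 ℬ [] → ∀ {A} → Nonempty A → A List.∈ 𝒜 ⊎ A List.∈ ℬ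
partition-complete {𝒜 = 𝒜} (partition p) A≠∅ = List.∈-++⁻ 𝒜 (↭.∈-resp-↭ (↭-sym p) (∈-nonemptySubsets A≠∅))

partition-in : ∀ {𝒜 ℬ : List (Subset n)} {C 𝒞} → Partition 𝒜 ℬ (C ∷ 𝒞) → Partition (C ∷ 𝒜) ℬ 𝒞
partition-in {𝒜 = 𝒜} {ℬ} {C} {𝒞} (partition p) = partition (↭-trans (↭.shift C 𝒞 (𝒜 ++ ℬ)) p)

partition-out : ∀ {𝒜 ℬ : List (Subset n)} {C 𝒞} → Partition 𝒜 ℬ (C ∷ 𝒞) → Partition 𝒜 (C ∷ ℬ) 𝒞
partition-out {𝒜 = 𝒜} {ℬ} {C} {𝒞} (partition p) =
  partition (↭-trans (↭.++⁺ˡ 𝒞 (↭.shift C 𝒜 ℬ)) (↭-trans (↭.shift C 𝒞 (𝒜 ++ ℬ)) p))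

_∈Orth?_ : (π : SetComposition n) (A : Subset n) → Dec (π ∈ Orth A)
π ∈Orth? A = ∣ A ∥ π ∣ ℕ.≟ 1

-- The empty set counts as resolved, because fromFamily ignores it although
-- no set composition is in Orth of it.

Resolved : Word n → Pred (Subset n) _
Resolved w A = Nonempty A → composition w ∈ Orth A

resolved? : (w : Word n) → Decidable (Resolved w)
resolved? w A = Subset.nonempty? A →-dec (composition w ∈Orth? A)

-- Construction of Υ on formal combinations of polytopes

module Hypergraphic {c ℓ₁ ℓ₂ r} (K : HeytingField c ℓ₁ ℓ₂) (ℝ : RealNumbers r) where

  open CommutativeRing (fieldCommutativeRing K) hiding (zero; isEquivalence)
  open RingProperties ring using (-1*x≈-x)
  open Exponentiation semiring using (_^_)
  open RealNumbers ℝ using () renaming (0# to 0ᴿ; _<_ to _<ᴿ_)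
  open Polytopes ℝ
  open Geometry ℝ using (0<?; generic⇔; _≃_; ≐⇒≃; FaceIsPoint-resp; ≃-sym; ≃-trans; fromFamily; 𝓕-fromFamily;
    points-fromFamily; points-fromFamily-cong; minkowskiSum-++)
  open _≃_
  open WordSymmetric K
  open Quasisymmetric K
  open FreeModule (fieldRing K) polytopes
  open HypergraphicPolytopes K ℝ
  open Alternating HGP
  open LeftModule series using () renaming
    (_≈ᴹ_ to _≈ˢ_; ≈ᴹ-sym to ≈ˢ-sym; ≈ᴹ-trans to ≈ˢ-trans)

  -- Genericity as a condition on the composition alone, quantified over a finite list so that it is
  -- decidable and can filter the enumeration.
  Respects : HypergraphicPolytope n → Pred (SetComposition n) _
  Respects {n} q π = All (λ J → 0ᴿ <ᴿ coeff q J → π ∈ Orth J) (nonemptySubsets n)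

  respects? : (q : HypergraphicPolytope n) → Decidable (Respects q)
  respects? q π = all? (λ J → 0<? (coeff q J) →-dec (π ∈Orth? J)) _

  Respects-resp : (q : HypergraphicPolytope n) → ∀ π τ → blocks π ≡ blocks τ → Respects q π → Respects q τ
  Respects-resp q π τ eq = All.map λ {J} orth 0<a → orth-blocks J {π} {τ} eq (orth 0<a)

  generic⇔respects : (q : HypergraphicPolytope n) (w : Word n) → w ∈ Generic q ⇔ Respects q (composition w)
  generic⇔respects {n} q w = ⇔-trans (generic⇔ q w) (mk⇔ f g)
    where
    f : (∀ {J} → J ∈ 𝓕 q → composition w ∈ Orth J) → Respects q (composition w)
    f orth = All.map (λ J≠∅ 0<a → orth (J≠∅ , 0<a)) (nonemptySubsets-nonempty n)
    g : Respects q (composition w) → ∀ {J} → J ∈ 𝓕 q → composition w ∈ Orth J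
    g all (J≠∅ , 0<a) = All.lookup all (∈-nonemptySubsets J≠∅) 0<a

  Υ₀ : Free → Series
  Υ₀ 0ᶠ          = LeftModule.0ᴹ series
  Υ₀ (x +ᶠ y)    = LeftModule._+ᴹ_ series (Υ₀ x) (Υ₀ y)
  Υ₀ (a *ᶠ x)    = LeftModule._*ₗ_ series a (Υ₀ x)
  Υ₀ [ n , q ]   = ∑ᴹ series (List.filter (respects? q) (setCompositions n)) M

  Υ₀-isMonomialSum : (q : HypergraphicPolytope n) → IsMonomialSum (Generic q) (Υ₀ ⟦ q ⟧)
  Υ₀-isMonomialSum {n} q = record
    { inside      = λ w generic →
        ∑M-inside (respects? q) (Respects-resp q) w (to (generic⇔respects q w) generic)
    ; outside     = λ w ¬generic →
        ∑M-outside (respects? q) (Respects-resp q) w (¬generic ∘ from (generic⇔respects q w))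
    ; otherDegree = λ m w m≢n → ∑M-otherDegree (List.filter (respects? q) (setCompositions n)) w m≢n
    }

  -- A monomial sum is prescribed on P and off P; decidability says which clause applies at a given
  -- word.
  monomialSum-unique : ∀ {p p′} {P : Pred (Word n) p} {Q : Pred (Word n) p′} {F G} →
    IsMonomialSum P F → IsMonomialSum Q G → Decidable P → P ≐ Q → F ≈ˢ G
  monomialSum-unique {n} F-sum G-sum P? (P⊆Q , Q⊆P) m w with m ℕ.≟ n
  ... | no m≢n = trans (F-sum .otherDegree m w m≢n) (sym (G-sum .otherDegree m w m≢n))
    where open IsMonomialSum
  ... | yes ≡.refl with P? w
  ...   | yes w∈P = trans (F-sum .inside w w∈P) (sym (G-sum .inside w (P⊆Q w∈P)))
    where open IsMonomialSum
  ...   | no w∉P = trans (F-sum .outside w w∉P) (sym (G-sum .outside w (w∉P ∘ Q⊆P)))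
    where open IsMonomialSum

  generic? : (q : HypergraphicPolytope n) → Decidable (Generic q)
  generic? q w = Decidable.map (⇔-sym (generic⇔respects q w)) (respects? q (composition w))

  Generic-cong : {p q : HypergraphicPolytope n} → points p ≐ points q → Generic p ≐ Generic q
  Generic-cong p≐q =
    (λ {w} → FaceIsPoint-resp {w = w} (≐⇒≃ p≐q)) ,
    (λ {w} → FaceIsPoint-resp {w = w} (≃-sym (≐⇒≃ p≐q)))

  Υ₀-cong : ∀ {x y} → x ≈ᶠ y → Υ₀ x ≈ˢ Υ₀ y
  Υ₀-cong ≈refl m w               = refl
  Υ₀-cong (≈sym x≈y) m w          = sym (Υ₀-cong x≈y m w)
  Υ₀-cong (≈trans x≈y y≈z) m w    = trans (Υ₀-cong x≈y m w) (Υ₀-cong y≈z m w)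
  -- The coefficients of p and q are not compared: genericity refers only to the point set.
  Υ₀-cong ([]-cong (same {p = p} {q} p≐q)) =
    monomialSum-unique (Υ₀-isMonomialSum p) (Υ₀-isMonomialSum q) (generic? p) (Generic-cong {p = p} {q} p≐q)
  Υ₀-cong (+ᶠ-cong x≈ y≈) m w     = +-cong (Υ₀-cong x≈ m w) (Υ₀-cong y≈ m w)
  Υ₀-cong (*ᶠ-cong a≈ x≈) m w     = *-cong a≈ (Υ₀-cong x≈ m w)
  Υ₀-cong (+ᶠ-assoc x y z) m w    = +-assoc _ _ _
  Υ₀-cong (+ᶠ-comm x y) m w       = +-comm _ _
  Υ₀-cong (+ᶠ-identˡ x) m w       = +-identityˡ _
  Υ₀-cong (*ᶠ-zeroˡ x) m w        = zeroˡ _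
  Υ₀-cong (*ᶠ-identˡ x) m w       = *-identityˡ _
  Υ₀-cong (*ᶠ-assoc a b x) m w    = *-assoc _ _ _
  Υ₀-cong (*ᶠ-distribˡ a x y) m w = distribˡ _ _ _
  Υ₀-cong (*ᶠ-distribʳ x a b) m w = distribʳ _ _ _

  Υ₀∈WQSym : ∀ x → Υ₀ x ∈ WQSym
  Υ₀∈WQSym 0ᶠ        = zero
  Υ₀∈WQSym (x +ᶠ y)  = add (Υ₀∈WQSym x) (Υ₀∈WQSym y)
  Υ₀∈WQSym (a *ᶠ x)  = scale a (Υ₀∈WQSym x)
  Υ₀∈WQSym [ n , q ] = ∑M∈WQSym (List.filter (respects? q) (setCompositions n))

  Υ₀-isΥ : IsΥ Υ₀
  Υ₀-isΥ = record
    { isLinear = record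
      { +ᴹ-isGroupHomomorphism = record
        { isMonoidHomomorphism = record
          { isMagmaHomomorphism = record
            { isRelHomomorphism = record { cong = Υ₀-cong }
            ; homo = λ x y m w → refl
            }
          ; ε-homo = λ m w → refl
          }
        ; ⁻¹-homo = λ x m w → -1*x≈-x _
        }
      ; *ₗ-homo = λ a x m w → refl
      }
    ; inWQSym = Υ₀∈WQSym
    ; onBasis = Υ₀-isMonomialSum
    }

  -- The alternating elements and the modular relations

  X : List (Subset n) → Free
  X 𝒜 = ⟦ fromFamily 𝒜 ⟧

  X-cong : {𝒜 ℬ : List (Subset n)} → (∀ {J} → J List.∈ 𝒜 ⇔ J List.∈ ℬ) → X 𝒜 ≈ᶠ X ℬ
  X-cong eqv = []-cong (same (≃⇒≐ (points-fromFamily-cong eqv)))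

  X-↭ : {𝒜 ℬ : List (Subset n)} → 𝒜 ↭ ℬ → X 𝒜 ≈ᶠ X ℬ
  X-↭ p = X-cong (mk⇔ (↭.∈-resp-↭ p) (↭.∈-resp-↭ (↭-sym p)))

  -- The alternating sum of the modular relation of 𝒜 and ℬ, without the
  -- covering condition on C_n: Υ maps it to the sum over the words resolving
  -- every member of 𝒜 and no member of ℬ.

  Δ : (𝒜 ℬ : List (Subset n)) → Free
  Δ 𝒜 ℬ = alternate (λ 𝒯 → X (𝒜 ++ 𝒯)) ℬ

  Δ-congˡ : ∀ {𝒜 𝒜′ : List (Subset n)} → (∀ {J} → J List.∈ 𝒜 ⇔ J List.∈ 𝒜′) → ∀ ℬ → Δ 𝒜 ℬ ≈ᶠ Δ 𝒜′ ℬ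
  Δ-congˡ {𝒜 = 𝒜} {𝒜′} eqv = alternate-cong λ 𝒯 → X-cong (mk⇔
    (λ J∈ → [ List.∈-++⁺ˡ ∘ to eqv , List.∈-++⁺ʳ 𝒜′ ]′ (List.∈-++⁻ 𝒜 J∈))
    (λ J∈ → [ List.∈-++⁺ˡ ∘ from eqv , List.∈-++⁺ʳ 𝒜 ]′ (List.∈-++⁻ 𝒜′ J∈)))

  -- Once every non-empty subset is placed, a non-empty member of 𝒮 outside ℬ is already in 𝒜, and
  -- repeated members do not change the polytope.
  Δ-absorb : ∀ {𝒜 ℬ 𝒮 : List (Subset n)} → Partition 𝒜 ℬ [] → All Nonempty 𝒮 → Disjoint 𝒮 ℬ →
             Δ (𝒜 ++ 𝒮) ℬ ≈ᶠ Δ 𝒜 ℬ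
  Δ-absorb {𝒜 = 𝒜} {ℬ} {𝒮} part 𝒮≠∅ 𝒮#ℬ =
    Δ-congˡ (mk⇔ (λ J∈ → [ id , 𝒮⊆𝒜 ]′ (List.∈-++⁻ 𝒜 J∈)) List.∈-++⁺ˡ) ℬ
    where
    𝒮⊆𝒜 : ∀ {J} → J List.∈ 𝒮 → J List.∈ 𝒜
    𝒮⊆𝒜 J∈𝒮 = [ id , (λ J∈ℬ → contradiction (J∈𝒮 , J∈ℬ) 𝒮#ℬ) ]′ (partition-complete part (All.lookup 𝒮≠∅ J∈𝒮))

  -- The first summand unfolds to `Δ 𝒜 ℬ` minus the terms containing C; the second restores these
  -- terms, with C moved to the front.
  Δ-split : ∀ (𝒜 : List (Subset n)) C ℬ → Δ 𝒜 ℬ ≈ᶠ Δ 𝒜 (C ∷ ℬ) +ᶠ Δ (C ∷ 𝒜) ℬ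
  Δ-split 𝒜 C ℬ = ≈sym (begin
    (Δ 𝒜 ℬ +ᶠ (- 1#) *ᶠ Δ′) +ᶠ Δ (C ∷ 𝒜) ℬ
      ≈⟨ +ᶠ-cong ≈refl (alternate-cong (λ 𝒯 → X-↭ (↭-sym (↭.shift C 𝒜 𝒯))) ℬ) ⟩
    (Δ 𝒜 ℬ +ᶠ (- 1#) *ᶠ Δ′) +ᶠ Δ′            ≈⟨ +ᶠ-assoc _ _ _ ⟩
    Δ 𝒜 ℬ +ᶠ ((- 1#) *ᶠ Δ′ +ᶠ Δ′)            ≈⟨ +ᶠ-cong ≈refl (LeftModule.-ᴹ‿inverseˡ HGP Δ′) ⟩
    Δ 𝒜 ℬ +ᶠ 0ᶠ                              ≈⟨ LeftModule.+ᴹ-identityʳ HGP _ ⟩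
    Δ 𝒜 ℬ                                    ∎)
    where
    open SetoidReasoning (LeftModule.≈ᴹ-setoid HGP)
    Δ′ = alternate (λ 𝒯 → X (𝒜 ++ C ∷ 𝒯)) ℬ

  points-fromFamily-++ : {𝒜 ℬ : List (Subset n)} → All Nonempty 𝒜 → Unique 𝒜 → All Nonempty ℬ → Unique ℬ →
    Disjoint 𝒜 ℬ →
    ∀ {𝒯} → 𝒯 List.∈ sublists ℬ → points (fromFamily (𝒜 ++ 𝒯)) ≃ (𝓕⁻¹ 𝒜 ⊕ 𝓕⁻¹ 𝒯)
  points-fromFamily-++ {𝒜 = 𝒜} {ℬ} 𝒜≠∅ 𝒜! ℬ≠∅ ℬ! 𝒜#ℬ {𝒯} 𝒯∈ = ≃-trans
    (points-fromFamily (All.++⁺ 𝒜≠∅ (Sublist.All-resp-⊆ 𝒯⊆ℬ ℬ≠∅))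
      (Unique.++⁺ 𝒜! (Unique-resp-⊇ 𝒯⊆ℬ ℬ!) (λ (J∈𝒜 , J∈𝒯) → 𝒜#ℬ (J∈𝒜 , Sublist.lookup 𝒯⊆ℬ J∈𝒯))))
    (minkowskiSum-++ simplex 𝒜 𝒯)
    where
    𝒯⊆ℬ = ∈-sublists⇒⊆ ℬ 𝒯∈

  -- A modular relation may use any polytopes q with the prescribed point sets, so each is compared
  -- with `fromFamily` through its points.
  modular≈Δ : {𝒜 ℬ : List (Subset n)} → All Nonempty 𝒜 → Unique 𝒜 → All Nonempty ℬ → Unique ℬ →
    Disjoint 𝒜 ℬ →
    (q : List (Subset n) → HypergraphicPolytope n) →
    (∀ {𝒯} → 𝒯 List.∈ sublists ℬ → points (q 𝒯) ≐ (𝓕⁻¹ 𝒜 ⊕ 𝓕⁻¹ 𝒯)) →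
    ∑ᴹ HGP (sublists ℬ) (λ 𝒯 → (- 1#) ^ length 𝒯 *ᶠ ⟦ q 𝒯 ⟧) ≈ᶠ Δ 𝒜 ℬ
  modular≈Δ {ℬ = ℬ} 𝒜≠∅ 𝒜! ℬ≠∅ ℬ! 𝒜#ℬ q q-points = ≈trans
    (∑-cong (sublists ℬ) λ 𝒯∈ → *ᶠ-cong refl ([]-cong (same (≃⇒≐ (≃-trans (≐⇒≃ (q-points 𝒯∈))
      (≃-sym (points-fromFamily-++ 𝒜≠∅ 𝒜! ℬ≠∅ ℬ! 𝒜#ℬ 𝒯∈)))))))
    (∑-sublists _ ℬ)

  Relations : Pred Free _
  Relations = Span HGP (SimpleRelation ∪ ModularRelation)

  Δ∈Relations : {𝒜 ℬ : List (Subset n)} → All Nonempty (𝒜 ++ ℬ) → Unique (𝒜 ++ ℬ) →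
                (∀ π → FailsToSeparate (λ A → π ∈ Orth A) 𝒜 ℬ) → Δ 𝒜 ℬ ∈ Relations
  Δ∈Relations {𝒜 = 𝒜} {ℬ} ≠∅ unique fails
    with 𝒜≠∅ , ℬ≠∅ ← All.++⁻ 𝒜 ≠∅ | 𝒜! , ℬ! , 𝒜#ℬ ← Unique-++⁻ 𝒜 unique =
    resp (modular≈Δ 𝒜≠∅ 𝒜! ℬ≠∅ ℬ! 𝒜#ℬ _ q-points)
         (gen (inj₂ (modular 𝒜 ℬ 𝒜≠∅ 𝒜! ℬ≠∅ ℬ! 𝒜#ℬ fails (λ 𝒯 → fromFamily (𝒜 ++ 𝒯)) q-points)))
    where
    q-points : ∀ {𝒯} → 𝒯 List.∈ sublists ℬ → points (fromFamily (𝒜 ++ 𝒯)) ≐ (𝓕⁻¹ 𝒜 ⊕ 𝓕⁻¹ 𝒯)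
    q-points 𝒯∈ = ≃⇒≐ (points-fromFamily-++ 𝒜≠∅ 𝒜! ℬ≠∅ ℬ! 𝒜#ℬ 𝒯∈)

  -- The linear maps from series back to HGP

  separates-wordOf : ∀ (π : SetComposition n) {𝒜 ℬ} → All Nonempty ℬ → Separates (λ A → π ∈ Orth A) 𝒜 ℬ →
                     Separates (Resolved (wordOf π)) 𝒜 ℬ
  separates-wordOf π ℬ≠∅ (in-𝒜 , out-ℬ) =
    All.map (λ {A} orth _ → to (orth-wordOf A π) orth) in-𝒜 ,
    -- `Resolved` holds vacuously of the empty set, so refuting it requires B to be non-empty.
    All.zipWith (λ {B} (B≠∅ , ¬orth) resolved → ¬orth (from (orth-wordOf B π) (resolved B≠∅))) (ℬ≠∅ , out-ℬ)

  realised? : (𝒜 ℬ : List (Subset n)) → Dec (∃ λ π → Separates (λ A → π ∈ Orth A) 𝒜 ℬ)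
  realised? {n} 𝒜 ℬ = Decidable.map′ Any.satisfied complete
    (any? (λ π → all? (π ∈Orth?_) 𝒜 ×-dec all? (¬? ∘ (π ∈Orth?_)) ℬ) (setCompositions n))
    where
    complete : (∃ λ π → Separates (λ A → π ∈ Orth A) 𝒜 ℬ) →
               Any (λ π → Separates (λ A → π ∈ Orth A) 𝒜 ℬ) (setCompositions n)
    complete (π , in-𝒜 , out-ℬ) with τ , τ∈ , eq ← setCompositions-complete π = List.lose τ∈
      (All.map (λ {A} → orth-blocks A {π} {τ} eq) in-𝒜 ,
       All.map (λ {A} ¬orth → ¬orth ∘ orth-blocks A {τ} {π} (≡.sym eq)) out-ℬ)

  -- A binary tree: each member of 𝒞 is put into 𝒜 or into ℬ, and a leaf
  -- realised by π contributes Δ 𝒜 ℬ with the coefficient of F at a word of π.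

  expand : (𝒜 ℬ 𝒞 : List (Subset n)) → Series → Free
  expand {n} 𝒜 ℬ []      F with realised? 𝒜 ℬ
  ... | yes (π , _) = F n (wordOf π) *ᶠ Δ 𝒜 ℬ
  ... | no _        = 0ᶠ
  expand 𝒜 ℬ (C ∷ 𝒞) F = expand 𝒜 (C ∷ ℬ) 𝒞 F +ᶠ expand (C ∷ 𝒜) ℬ 𝒞 F

  -- A leaf below this node reads F only at a word separating the final lists, which contain 𝒜 and
  -- ℬ; agreement on words separating 𝒜 from ℬ is therefore enough. This locality lets each subtree
  -- ignore the part of a series that belongs to the other.
  expand-cong : ∀ (𝒜 ℬ 𝒞 : List (Subset n)) {F G} → All Nonempty ℬ → All Nonempty 𝒞 →
                (∀ w → Separates (Resolved w) 𝒜 ℬ → F n w ≈ G n w) → expand 𝒜 ℬ 𝒞 F ≈ᶠ expand 𝒜 ℬ 𝒞 G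
  expand-cong 𝒜 ℬ [] ℬ-ne [] F≈G with realised? 𝒜 ℬ
  ... | yes (π , sep) = *ᶠ-cong (F≈G (wordOf π) (separates-wordOf π ℬ-ne sep)) ≈refl
  ... | no _          = ≈refl
  expand-cong 𝒜 ℬ (C ∷ 𝒞) ℬ-ne (C≠∅ ∷ 𝒞-ne) F≈G = +ᶠ-cong
    (expand-cong 𝒜 (C ∷ ℬ) 𝒞 (C≠∅ ∷ ℬ-ne) 𝒞-ne λ { w (in-𝒜 , _ ∷ out-ℬ) → F≈G w (in-𝒜 , out-ℬ) })
    (expand-cong (C ∷ 𝒜) ℬ 𝒞 ℬ-ne 𝒞-ne λ { w (_ ∷ in-𝒜 , out-ℬ) → F≈G w (in-𝒜 , out-ℬ) })

  open LeftModule HGP using () renaming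
    (≈ᴹ-setoid to HGP-setoid; +ᴹ-identityʳ to +ᶠ-identʳ; *ₗ-zeroʳ to *ᶠ-zeroʳ; +ᴹ-commutativeMonoid to HGP-+)
  open LeftModule series using () renaming (_+ᴹ_ to _+ˢ_; _*ₗ_ to _*ˢ_; 0ᴹ to 0ˢ)

  expand-0 : (𝒜 ℬ 𝒞 : List (Subset n)) → expand 𝒜 ℬ 𝒞 0ˢ ≈ᶠ 0ᶠ
  expand-0 𝒜 ℬ []      with realised? 𝒜 ℬ
  ... | yes _ = *ᶠ-zeroˡ _
  ... | no _  = ≈refl
  expand-0 𝒜 ℬ (C ∷ 𝒞) = ≈trans (+ᶠ-cong (expand-0 𝒜 (C ∷ ℬ) 𝒞) (expand-0 (C ∷ 𝒜) ℬ 𝒞)) (+ᶠ-identˡ 0ᶠ)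

  +ᶠ-interchange : ∀ w x y z → (w +ᶠ x) +ᶠ (y +ᶠ z) ≈ᶠ (w +ᶠ y) +ᶠ (x +ᶠ z)
  +ᶠ-interchange = interchange
    where open CommutativeSemigroupProperties (CommutativeMonoid.commutativeSemigroup HGP-+)

  expand-+ : ∀ (𝒜 ℬ 𝒞 : List (Subset n)) F G → expand 𝒜 ℬ 𝒞 (F +ˢ G) ≈ᶠ expand 𝒜 ℬ 𝒞 F +ᶠ expand 𝒜 ℬ 𝒞 G
  expand-+ 𝒜 ℬ []      F G with realised? 𝒜 ℬ
  ... | yes _ = *ᶠ-distribʳ _ _ _
  ... | no _  = ≈sym (+ᶠ-identˡ 0ᶠ)
  expand-+ 𝒜 ℬ (C ∷ 𝒞) F G =
    ≈trans (+ᶠ-cong (expand-+ 𝒜 (C ∷ ℬ) 𝒞 F G) (expand-+ (C ∷ 𝒜) ℬ 𝒞 F G)) (+ᶠ-interchange _ _ _ _)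

  expand-* : ∀ (𝒜 ℬ 𝒞 : List (Subset n)) a F → expand 𝒜 ℬ 𝒞 (a *ˢ F) ≈ᶠ a *ᶠ expand 𝒜 ℬ 𝒞 F
  expand-* 𝒜 ℬ []      a F with realised? 𝒜 ℬ
  ... | yes _ = *ᶠ-assoc _ _ _
  ... | no _  = ≈sym (*ᶠ-zeroʳ a)
  expand-* 𝒜 ℬ (C ∷ 𝒞) a F =
    ≈trans (+ᶠ-cong (expand-* 𝒜 (C ∷ ℬ) 𝒞 a F) (expand-* (C ∷ 𝒜) ℬ 𝒞 a F)) (≈sym (*ᶠ-distribˡ _ _ _))

  -- The clause for `suc n` adds degree n, so a polytope in dimension n is seen exactly by the
  -- indices above n.
  expandBelow : ℕ → Series → Free
  expandBelow 0       F = 0ᶠ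
  expandBelow (suc n) F = expandBelow n F +ᶠ expand [] [] (nonemptySubsets n) F

  expandBelow-0 : ∀ n → expandBelow n 0ˢ ≈ᶠ 0ᶠ
  expandBelow-0 0       = ≈refl
  expandBelow-0 (suc n) = ≈trans (+ᶠ-cong (expandBelow-0 n) (expand-0 [] [] (nonemptySubsets n))) (+ᶠ-identˡ 0ᶠ)

  expandBelow-+ : ∀ n F G → expandBelow n (F +ˢ G) ≈ᶠ expandBelow n F +ᶠ expandBelow n G
  expandBelow-+ 0       F G = ≈sym (+ᶠ-identˡ 0ᶠ)
  expandBelow-+ (suc n) F G =
    ≈trans (+ᶠ-cong (expandBelow-+ n F G) (expand-+ [] [] (nonemptySubsets n) F G)) (+ᶠ-interchange _ _ _ _)

  expandBelow-* : ∀ n a F → expandBelow n (a *ˢ F) ≈ᶠ a *ᶠ expandBelow n F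
  expandBelow-* 0       a F = ≈sym (*ᶠ-zeroʳ a)
  expandBelow-* (suc n) a F =
    ≈trans (+ᶠ-cong (expandBelow-* n a F) (expand-* [] [] (nonemptySubsets n) a F)) (≈sym (*ᶠ-distribˡ _ _ _))

  expand-top-cong : ∀ n {F G} → (∀ w → F n w ≈ G n w) →
                    expand [] [] (nonemptySubsets n) F ≈ᶠ expand [] [] (nonemptySubsets n) G
  expand-top-cong n F≈G = expand-cong [] [] (nonemptySubsets n) [] (nonemptySubsets-nonempty n) (λ w _ → F≈G w)

  expandBelow-cong : ∀ n {F G} → F ≈ˢ G → expandBelow n F ≈ᶠ expandBelow n G
  expandBelow-cong 0       F≈G = ≈refl
  expandBelow-cong (suc n) F≈G = +ᶠ-cong (expandBelow-cong n F≈G) (expand-top-cong n (F≈G n))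

  expandBelow-vanishing : ∀ {F} n → (∀ {m} → m ℕ.< n → (w : Word m) → F m w ≈ 0#) → expandBelow n F ≈ᶠ 0ᶠ
  expandBelow-vanishing 0       F≈0 = ≈refl
  expandBelow-vanishing (suc n) F≈0 = ≈trans
    (+ᶠ-cong (expandBelow-vanishing n (λ m<n → F≈0 (ℕ.m<n⇒m<1+n m<n)))
             (≈trans (expand-top-cong n (F≈0 ℕ.≤-refl)) (expand-0 [] [] (nonemptySubsets n))))
    (+ᶠ-identˡ 0ᶠ)

  expandBelow-homogeneous : ∀ {F m} → (∀ {k} → k ≢ m → (w : Word k) → F k w ≈ 0#) →
                            ∀ {n} → m ℕ.< n → expandBelow n F ≈ᶠ expand [] [] (nonemptySubsets m) F
  expandBelow-homogeneous {F} {m} F≈0 {suc n} m<1+n with n ℕ.≟ m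
  ... | yes ≡.refl = ≈trans (+ᶠ-cong (expandBelow-vanishing m (F≈0 ∘ ℕ.<⇒≢)) ≈refl) (+ᶠ-identˡ _)
  ... | no n≢m = ≈trans
    (+ᶠ-cong (expandBelow-homogeneous F≈0 (ℕ.≤∧≢⇒< (ℕ.s≤s⁻¹ m<1+n) (n≢m ∘ ≡.sym)))
             (≈trans (expand-top-cong n (F≈0 n≢m)) (expand-0 [] [] (nonemptySubsets n))))
    (+ᶠ-identʳ _)

  -- Values of any admissible Υ on the alternating elements

  module _ {Υ : Free → Series} (isΥ : IsΥ Υ) where

    open IsΥ isΥ
    open LeftModuleMorphisms (LeftModule.rawLeftModule HGP) (LeftModule.rawLeftModule series)
    open IsLeftModuleHomomorphism isLinear using () renaming
      (⟦⟧-cong to Υ-cong; +ᴹ-homo to Υ-+; *ₗ-homo to Υ-*; 0ᴹ-homo to Υ-0; -ᴹ-homo to Υ-‿)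

    Υ-X-all : ∀ {𝒜} (w : Word n) → All (Resolved w) 𝒜 → Υ (X 𝒜) n w ≈ 1#
    Υ-X-all {𝒜 = 𝒜} w all = IsMonomialSum.inside (onBasis (fromFamily 𝒜)) w
      (from (generic⇔ (fromFamily 𝒜) w) λ J∈ → let J≠∅ , J∈𝒜 = to 𝓕-fromFamily J∈ in All.lookup all J∈𝒜 J≠∅)

    Υ-X-any : ∀ {𝒜} (w : Word n) → Any (∁ (Resolved w)) 𝒜 → Υ (X 𝒜) n w ≈ 0#
    Υ-X-any {𝒜 = 𝒜} w any with J , J∈𝒜 , ¬resolved ← find any =
      IsMonomialSum.outside (onBasis (fromFamily 𝒜)) w λ generic →
        ¬resolved λ J≠∅ → to (generic⇔ (fromFamily 𝒜) w) generic (from 𝓕-fromFamily (J≠∅ , J∈𝒜))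

    module _ (w : Word n) where

      open Functional (λ x → Υ x n w) (λ x y → Υ-+ x y n w) (λ k x → Υ-* k x n w)

      Υ-Δ-separates : ∀ 𝒜 ℬ → Separates (Resolved w) 𝒜 ℬ → Υ (Δ 𝒜 ℬ) n w ≈ 1#
      Υ-Δ-separates 𝒜 ℬ (in-𝒜 , out-ℬ) = alternate-none (resolved? w)
        ((λ all → Υ-X-all w (All.++⁺ in-𝒜 all)) , (λ any → Υ-X-any w (Any.++⁺ʳ 𝒜 any))) out-ℬ

      Υ-Δ-fails : ∀ 𝒜 ℬ → FailsToSeparate (Resolved w) 𝒜 ℬ → Υ (Δ 𝒜 ℬ) n w ≈ 0#
      -- An unresolved member of 𝒜 occurs in every term and kills them all. Only when 𝒜 is resolved
      -- is the value an indicator in 𝒯, so that a resolved member of ℬ gives pairwise cancellation.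
      Υ-Δ-fails 𝒜 ℬ fails with All.decide (toSum ∘ resolved? w) 𝒜 | fails
      ... | inj₂ any   | _          = alternate-zero (λ 𝒯 → Υ-X-any w (Any.++⁺ˡ any)) ℬ
      ... | inj₁ in-𝒜 | inj₁ any   = contradiction in-𝒜 (All.Any¬⇒¬All any)
      ... | inj₁ in-𝒜 | inj₂ any   = alternate-any (resolved? w)
        ((λ all → Υ-X-all w (All.++⁺ in-𝒜 all)) , (λ any′ → Υ-X-any w (Any.++⁺ʳ 𝒜 any′))) any

    Υ-Δ-otherDegree : ∀ {m} (w : Word m) → m ≢ n → (𝒜 ℬ : List (Subset n)) → Υ (Δ 𝒜 ℬ) m w ≈ 0#
    Υ-Δ-otherDegree {m = m} w m≢n 𝒜 = Functional.alternate-zero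
      (λ x → Υ x m w) (λ x y → Υ-+ x y m w) (λ k x → Υ-* k x m w)
      (λ 𝒯 → IsMonomialSum.otherDegree (onBasis (fromFamily (𝒜 ++ 𝒯))) m w m≢n)

    -- Since 𝒜 and ℬ exhaust the non-empty subsets, separating them fixes every membership in Orth;
    -- the words doing so are those whose composition is equivalent to π.
    Υ-Δ≈N : ∀ {𝒜 ℬ : List (Subset n)} {π} → All Nonempty 𝒜 → All Nonempty ℬ →
            (∀ {A} → Nonempty A → A List.∈ 𝒜 ⊎ A List.∈ ℬ) → Separates (λ A → π ∈ Orth A) 𝒜 ℬ → Υ (Δ 𝒜 ℬ) ≈ˢ N π
    Υ-Δ≈N {n} {𝒜} {ℬ} {π} 𝒜≠∅ ℬ≠∅ complete (in-𝒜 , out-ℬ) m w with m ℕ.≟ n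
    ... | no m≢n = trans (Υ-Δ-otherDegree w m≢n 𝒜 ℬ) (sym (N-otherDegree π w m≢n))
    ... | yes ≡.refl with separates? (resolved? w) 𝒜 ℬ
    ...   | inj₁ sep@(res-𝒜 , ¬res-ℬ) = trans (Υ-Δ-separates w 𝒜 ℬ sep) (sym (N-inside π w w∼π))
      where
      w∼π : composition w ∼ π
      w∼π A A≠∅ with complete A≠∅
      ... | inj₁ A∈𝒜 = mk⇔ (λ _ → All.lookup in-𝒜 A∈𝒜) (λ _ → All.lookup res-𝒜 A∈𝒜 A≠∅)
      ... | inj₂ A∈ℬ = mk⇔ (λ orth → contradiction (λ _ → orth) (All.lookup ¬res-ℬ A∈ℬ))
                           (λ orth → contradiction orth (All.lookup out-ℬ A∈ℬ))
    ...   | inj₂ fails = trans (Υ-Δ-fails w 𝒜 ℬ fails) (sym (N-outside π w (w≁π fails)))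
      where
      w≁π : FailsToSeparate (Resolved w) 𝒜 ℬ → ¬ composition w ∼ π
      w≁π (inj₁ any) w∼π with A , A∈𝒜 , ¬res ← find any =
        ¬res λ A≠∅ → from (w∼π A A≠∅) (All.lookup in-𝒜 A∈𝒜)
      w≁π (inj₂ any) w∼π with B , B∈ℬ , res ← find any =
        let B≠∅ = All.lookup ℬ≠∅ B∈ℬ in All.lookup out-ℬ B∈ℬ (to (w∼π B B≠∅) (res B≠∅))

    Υ-simple : (p q : HypergraphicPolytope n) → 𝓕 p ≐ 𝓕 q → Υ ⟦ p ⟧ ≈ˢ Υ ⟦ q ⟧
    Υ-simple p q (𝓕p⊆𝓕q , 𝓕q⊆𝓕p) = monomialSum-unique (onBasis p) (onBasis q) (generic? p)
      ((λ {w} generic → from (generic⇔ q w) λ J∈ → to (generic⇔ p w) generic (𝓕q⊆𝓕p J∈)) ,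
       (λ {w} generic → from (generic⇔ p w) λ J∈ → to (generic⇔ q w) generic (𝓕p⊆𝓕q J∈)))

    relations⊆kernel : Relations ⊆ Kernel Υ
    relations⊆kernel (gen (inj₁ (simple p q 𝓕p≐𝓕q))) m w = trans (Υ-+ ⟦ p ⟧ (-ᶠ ⟦ q ⟧) m w)
      (trans (+-cong (Υ-simple p q 𝓕p≐𝓕q m w) (Υ-‿ ⟦ q ⟧ m w)) (-‿inverseʳ _))
    relations⊆kernel (gen (inj₂ (modular {n} 𝒜 ℬ 𝒜≠∅ 𝒜! ℬ≠∅ ℬ! 𝒜#ℬ fails q q-points))) m w =
      trans (Υ-cong (modular≈Δ 𝒜≠∅ 𝒜! ℬ≠∅ ℬ! 𝒜#ℬ q q-points) m w) Υ-Δ≈0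
      where
      resolve : ∀ (w : Word n) → FailsToSeparate (λ A → composition w ∈ Orth A) 𝒜 ℬ →
                FailsToSeparate (Resolved w) 𝒜 ℬ
      resolve w (inj₁ any) with A , A∈𝒜 , ¬orth ← find any =
        inj₁ (List.lose A∈𝒜 λ res → ¬orth (res (All.lookup 𝒜≠∅ A∈𝒜)))
      resolve w (inj₂ any) = inj₂ (Any.map (λ orth _ → orth) any)
      Υ-Δ≈0 : Υ (Δ 𝒜 ℬ) m w ≈ 0#
      Υ-Δ≈0 with m ℕ.≟ n
      ... | no m≢n     = Υ-Δ-otherDegree w m≢n 𝒜 ℬ
      ... | yes ≡.refl = Υ-Δ-fails w 𝒜 ℬ (resolve w (fails (composition w)))
    relations⊆kernel zero          m w = Υ-0 m w
    relations⊆kernel (add {x} {y} x∈ y∈)   m w =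
      trans (Υ-+ x y m w) (trans (+-cong (relations⊆kernel x∈ m w) (relations⊆kernel y∈ m w)) (+-identityˡ 0#))
    relations⊆kernel (scale a {x} x∈)  m w = trans (Υ-* a x m w) (trans (*-congˡ (relations⊆kernel x∈ m w)) (zeroʳ a))
    relations⊆kernel (resp x≈y x∈) m w = trans (sym (Υ-cong x≈y m w)) (relations⊆kernel x∈ m w)

    -- Reconstruction modulo relations, and the kernel

    infix 4 _≡ᴿ_

    _≡ᴿ_ : Free → Free → Set _
    x ≡ᴿ y = ∃ λ z → z ∈ Relations × x ≈ᶠ y +ᶠ z

    -- Here 𝒮 is the family to be expanded and stays fixed down the tree. At the root the left side
    -- is `X 𝒮` up to an empty tail, and at a leaf 𝒜 has absorbed 𝒮. Disjointness from ℬ survives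
    -- because the induction rejects C only when C is not in 𝒮.
    expand-Δ : ∀ {𝒜 ℬ 𝒞 𝒮 : List (Subset n)} → Partition 𝒜 ℬ 𝒞 → All Nonempty 𝒮 → Disjoint 𝒮 ℬ →
               Δ (𝒜 ++ 𝒮) ℬ ≡ᴿ expand 𝒜 ℬ 𝒞 (Υ (Δ (𝒜 ++ 𝒮) ℬ))
    expand-Δ {n} {𝒜} {ℬ} {[]} {𝒮} part 𝒮≠∅ 𝒮#ℬ with realised? 𝒜 ℬ
    -- At a realised leaf the coefficient read is 1, so the reconstruction is exact.
    ... | yes (π , sep) = 0ᶠ , zero , (begin
      y                                  ≈⟨ y≈Δ ⟩
      Δ 𝒜 ℬ                              ≈⟨ *ᶠ-identˡ _ ⟨
      1# *ᶠ Δ 𝒜 ℬ                        ≈⟨ *ᶠ-cong Υy≈1 ≈refl ⟨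
      Υ y n (wordOf π) *ᶠ Δ 𝒜 ℬ          ≈⟨ +ᶠ-identʳ _ ⟨
      Υ y n (wordOf π) *ᶠ Δ 𝒜 ℬ +ᶠ 0ᶠ    ∎)
      where
      open SetoidReasoning HGP-setoid
      y = Δ (𝒜 ++ 𝒮) ℬ
      y≈Δ : y ≈ᶠ Δ 𝒜 ℬ
      y≈Δ = Δ-absorb part 𝒮≠∅ 𝒮#ℬ
      Υy≈1 : Υ y n (wordOf π) ≈ 1#
      Υy≈1 = trans (Υ-cong y≈Δ n (wordOf π))
        (Υ-Δ-separates (wordOf π) 𝒜 ℬ (separates-wordOf π (ℬ≠∅ part) sep))
    -- An unrealised leaf contributes nothing to `expand`; its element is a modular relation and
    -- becomes the remainder.
    ... | no ¬realised = Δ (𝒜 ++ 𝒮) ℬ , resp (≈sym y≈Δ) (Δ∈Relations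
        (All.++⁺ (𝒜≠∅ part) (ℬ≠∅ part)) (unique part) fails) , ≈sym (+ᶠ-identˡ _)
      where
      y≈Δ : Δ (𝒜 ++ 𝒮) ℬ ≈ᶠ Δ 𝒜 ℬ
      y≈Δ = Δ-absorb part 𝒮≠∅ 𝒮#ℬ
      fails : ∀ π → FailsToSeparate (λ A → π ∈ Orth A) 𝒜 ℬ
      fails π with separates? (π ∈Orth?_) 𝒜 ℬ
      ... | inj₁ sep   = contradiction (π , sep) ¬realised
      ... | inj₂ fails = fails
    expand-Δ {n} {𝒜} {ℬ} {C ∷ 𝒞} {𝒮} part 𝒮≠∅ 𝒮#ℬ with Geometry._∈?_ ℝ C 𝒮
    ... | yes C∈𝒮 = z , z∈ , (begin
      y                                                       ≈⟨ y≈y′ ⟩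
      y′                                                      ≈⟨ y′≈ ⟩
      expand (C ∷ 𝒜) ℬ 𝒞 (Υ y′) +ᶠ z                           ≈⟨ +ᶠ-cong (+ᶠ-identˡ _) ≈refl ⟨
      (0ᶠ +ᶠ expand (C ∷ 𝒜) ℬ 𝒞 (Υ y′)) +ᶠ z                   ≈⟨ +ᶠ-cong (+ᶠ-cong out into) ≈refl ⟨
      (expand 𝒜 (C ∷ ℬ) 𝒞 (Υ y) +ᶠ expand (C ∷ 𝒜) ℬ 𝒞 (Υ y)) +ᶠ z  ∎)
      where
      open SetoidReasoning HGP-setoid
      ih = expand-Δ {𝒜 = C ∷ 𝒜} {ℬ} {𝒞} {𝒮} (partition-in part) 𝒮≠∅ 𝒮#ℬ
      z  = proj₁ ih
      z∈ = proj₁ (proj₂ ih)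
      y  = Δ (𝒜 ++ 𝒮) ℬ
      y′ = Δ (C ∷ 𝒜 ++ 𝒮) ℬ
      y′≈ : y′ ≈ᶠ expand (C ∷ 𝒜) ℬ 𝒞 (Υ y′) +ᶠ z
      y′≈ = proj₂ (proj₂ ih)
      y≈y′ : y ≈ᶠ y′
      y≈y′ = Δ-congˡ (mk⇔ there λ { (here ≡.refl) → List.∈-++⁺ʳ 𝒜 C∈𝒮 ; (there J∈) → J∈ }) ℬ
      into : expand (C ∷ 𝒜) ℬ 𝒞 (Υ y) ≈ᶠ expand (C ∷ 𝒜) ℬ 𝒞 (Υ y′)
      into = expand-cong (C ∷ 𝒜) ℬ 𝒞 (ℬ≠∅ part) (𝒞≠∅ (partition-in part)) (λ w _ → Υ-cong y≈y′ n w)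
      -- The words read in this subtree do not resolve C, which occurs in every term of y.
      out : expand 𝒜 (C ∷ ℬ) 𝒞 (Υ y) ≈ᶠ 0ᶠ
      out = ≈trans (expand-cong 𝒜 (C ∷ ℬ) 𝒞 (ℬ≠∅ (partition-out part)) (𝒞≠∅ (partition-in part))
          λ { w (_ , ¬res ∷ _) → Υ-Δ-fails w (𝒜 ++ 𝒮) ℬ (inj₁ (Any.++⁺ʳ 𝒜 (List.lose C∈𝒮 ¬res))) })
        (expand-0 𝒜 (C ∷ ℬ) 𝒞)
    ... | no C∉𝒮 = z₁ +ᶠ z₂ , add z₁∈ z₂∈ , (begin
      y                                             ≈⟨ Δ-split (𝒜 ++ 𝒮) C ℬ ⟩
      y₁ +ᶠ y₂                                      ≈⟨ +ᶠ-cong y₁≈ y₂≈ ⟩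
      (expand 𝒜 (C ∷ ℬ) 𝒞 (Υ y₁) +ᶠ z₁) +ᶠ (expand (C ∷ 𝒜) ℬ 𝒞 (Υ y₂) +ᶠ z₂)
        ≈⟨ +ᶠ-interchange _ _ _ _ ⟩
      (expand 𝒜 (C ∷ ℬ) 𝒞 (Υ y₁) +ᶠ expand (C ∷ 𝒜) ℬ 𝒞 (Υ y₂)) +ᶠ (z₁ +ᶠ z₂)
        ≈⟨ +ᶠ-cong (+ᶠ-cong out into) ≈refl ⟨
      (expand 𝒜 (C ∷ ℬ) 𝒞 (Υ y) +ᶠ expand (C ∷ 𝒜) ℬ 𝒞 (Υ y)) +ᶠ (z₁ +ᶠ z₂)  ∎)
      where
      open SetoidReasoning HGP-setoid
      𝒮#C∷ℬ : Disjoint 𝒮 (C ∷ ℬ)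
      𝒮#C∷ℬ (J∈𝒮 , here ≡.refl) = C∉𝒮 J∈𝒮
      𝒮#C∷ℬ (J∈𝒮 , there J∈ℬ)   = 𝒮#ℬ (J∈𝒮 , J∈ℬ)
      ih₁ = expand-Δ {𝒜 = 𝒜} {C ∷ ℬ} {𝒞} {𝒮} (partition-out part) 𝒮≠∅ 𝒮#C∷ℬ
      ih₂ = expand-Δ {𝒜 = C ∷ 𝒜} {ℬ} {𝒞} {𝒮} (partition-in part) 𝒮≠∅ 𝒮#ℬ
      z₁  = proj₁ ih₁
      z₂  = proj₁ ih₂
      z₁∈ = proj₁ (proj₂ ih₁)
      z₂∈ = proj₁ (proj₂ ih₂)
      y  = Δ (𝒜 ++ 𝒮) ℬ
      y₁ = Δ (𝒜 ++ 𝒮) (C ∷ ℬ)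
      y₂ = Δ (C ∷ 𝒜 ++ 𝒮) ℬ
      y₁≈ : y₁ ≈ᶠ expand 𝒜 (C ∷ ℬ) 𝒞 (Υ y₁) +ᶠ z₁
      y₁≈ = proj₂ (proj₂ ih₁)
      y₂≈ : y₂ ≈ᶠ expand (C ∷ 𝒜) ℬ 𝒞 (Υ y₂) +ᶠ z₂
      y₂≈ = proj₂ (proj₂ ih₂)
      Υy : ∀ w → Υ y n w ≈ Υ y₁ n w + Υ y₂ n w
      Υy w = trans (Υ-cong (Δ-split (𝒜 ++ 𝒮) C ℬ) n w) (Υ-+ y₁ y₂ n w)
      -- On words not resolving C the series of y₂ vanishes, and on words resolving C that of y₁
      -- does. Hence each subtree, reading y, sees only its own half.
      out : expand 𝒜 (C ∷ ℬ) 𝒞 (Υ y) ≈ᶠ expand 𝒜 (C ∷ ℬ) 𝒞 (Υ y₁)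
      out = expand-cong 𝒜 (C ∷ ℬ) 𝒞 (ℬ≠∅ (partition-out part)) (𝒞≠∅ (partition-in part))
        λ { w (_ , ¬res ∷ _) → trans (Υy w)
          (trans (+-congˡ (Υ-Δ-fails w (C ∷ 𝒜 ++ 𝒮) ℬ (inj₁ (here ¬res)))) (+-identityʳ _)) }
      into : expand (C ∷ 𝒜) ℬ 𝒞 (Υ y) ≈ᶠ expand (C ∷ 𝒜) ℬ 𝒞 (Υ y₂)
      into = expand-cong (C ∷ 𝒜) ℬ 𝒞 (ℬ≠∅ part) (𝒞≠∅ (partition-in part))
        λ { w (res ∷ _ , _) → trans (Υy w)
          (trans (+-congʳ (Υ-Δ-fails w (𝒜 ++ 𝒮) (C ∷ ℬ) (inj₂ (here res)))) (+-identityˡ _)) }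

    expandBelow-basis : (q : HypergraphicPolytope n) → ∀ {k} → n ℕ.< k → ⟦ q ⟧ ≡ᴿ expandBelow k (Υ ⟦ q ⟧)
    expandBelow-basis {n} q {k} n<k = z +ᶠ s , add (proj₁ (proj₂ y≡)) s∈ , (begin
      ⟦ q ⟧                               ≈⟨ q≈y+s ⟩
      y +ᶠ s                              ≈⟨ +ᶠ-cong (proj₂ (proj₂ y≡)) ≈refl ⟩
      (expand [] [] (nonemptySubsets n) (Υ y) +ᶠ z) +ᶠ s   ≈⟨ +ᶠ-assoc _ _ _ ⟩
      expand [] [] (nonemptySubsets n) (Υ y) +ᶠ (z +ᶠ s)
        ≈⟨ +ᶠ-cong (expand-top-cong n (Υy≈Υq n)) ≈refl ⟩
      expand [] [] (nonemptySubsets n) (Υ ⟦ q ⟧) +ᶠ (z +ᶠ s)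
        ≈⟨ +ᶠ-cong (expandBelow-homogeneous (λ m≢n w → IsMonomialSum.otherDegree (onBasis q) _ w m≢n) n<k) ≈refl ⟨
      expandBelow k (Υ ⟦ q ⟧) +ᶠ (z +ᶠ s)  ∎)
      where
      open SetoidReasoning HGP-setoid
      -- This list is 𝓕(q); the simple relation s below replaces q by the representative of its
      -- family.
      𝒮 = List.filter (λ J → 0<? (coeff q J)) (nonemptySubsets n)
      y = Δ 𝒮 []
      y≡ : y ≡ᴿ expand [] [] (nonemptySubsets n) (Υ y)
      y≡ = expand-Δ {𝒜 = []} {[]} {nonemptySubsets n} {𝒮}
        (trivialPartition n) (All.filter⁺ _ (nonemptySubsets-nonempty n)) (λ ())
      z = proj₁ y≡
      s = ⟦ q ⟧ +ᶠ (-ᶠ X 𝒮)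
      𝓕q≐𝓕𝒮 : 𝓕 q ≐ 𝓕 (fromFamily 𝒮)
      𝓕q≐𝓕𝒮 = (λ (J≠∅ , 0<a) → from 𝓕-fromFamily (J≠∅ , List.∈-filter⁺ _ (∈-nonemptySubsets J≠∅) 0<a)) ,
                (λ J∈ → let J≠∅ , J∈𝒮 = to 𝓕-fromFamily J∈ in
                   J≠∅ , proj₂ (List.∈-filter⁻ _ {xs = nonemptySubsets n} J∈𝒮))
      s∈ : s ∈ Relations
      s∈ = gen (inj₁ (simple q (fromFamily 𝒮) 𝓕q≐𝓕𝒮))
      y≈X𝒮 : y ≈ᶠ X 𝒮
      y≈X𝒮 = X-↭ (↭-reflexive (List.++-identityʳ 𝒮))
      q≈y+s : ⟦ q ⟧ ≈ᶠ y +ᶠ s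
      q≈y+s = ≈sym (begin
        y +ᶠ (⟦ q ⟧ +ᶠ (-ᶠ X 𝒮))      ≈⟨ +ᶠ-cong y≈X𝒮 (+ᶠ-comm _ _) ⟩
        X 𝒮 +ᶠ ((-ᶠ X 𝒮) +ᶠ ⟦ q ⟧)    ≈⟨ +ᶠ-assoc _ _ _ ⟨
        (X 𝒮 +ᶠ (-ᶠ X 𝒮)) +ᶠ ⟦ q ⟧    ≈⟨ +ᶠ-cong (LeftModule.-ᴹ‿inverseʳ HGP (X 𝒮)) ≈refl ⟩
        0ᶠ +ᶠ ⟦ q ⟧                   ≈⟨ +ᶠ-identˡ _ ⟩
        ⟦ q ⟧                         ∎)
      Υy≈Υq : Υ y ≈ˢ Υ ⟦ q ⟧
      Υy≈Υq = ≈ˢ-trans {i = Υ y} {Υ (X 𝒮)} {Υ ⟦ q ⟧} (Υ-cong y≈X𝒮)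
        (≈ˢ-sym {Υ ⟦ q ⟧} {Υ (X 𝒮)} (Υ-simple q (fromFamily 𝒮) 𝓕q≐𝓕𝒮))

    -- Claiming the congruence for every k from some bound on, not for one k, lets two summands
    -- share the larger of their bounds.
    expandBelow-Υ : ∀ x → ∃ λ N → ∀ {k} → N ℕ.≤ k → x ≡ᴿ expandBelow k (Υ x)
    expandBelow-Υ 0ᶠ = 0 , λ {k} _ → 0ᶠ , zero ,
      ≈sym (≈trans (+ᶠ-identʳ _) (≈trans (expandBelow-cong k Υ-0) (expandBelow-0 k)))
    expandBelow-Υ (x +ᶠ y) with N₁ , x≡ ← expandBelow-Υ x | N₂ , y≡ ← expandBelow-Υ y = N₁ ℕ.⊔ N₂ , λ {k} N≤k →
      let z₁ , z₁∈ , x≈ = x≡ {k} (ℕ.≤-trans (ℕ.m≤m⊔n N₁ N₂) N≤k)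
          z₂ , z₂∈ , y≈ = y≡ {k} (ℕ.≤-trans (ℕ.m≤n⊔m N₁ N₂) N≤k)
      in z₁ +ᶠ z₂ , add z₁∈ z₂∈ , ≈trans (+ᶠ-cong x≈ y≈) (≈trans (+ᶠ-interchange _ _ _ _)
           (+ᶠ-cong (≈sym (≈trans (expandBelow-cong k (Υ-+ x y)) (expandBelow-+ k (Υ x) (Υ y)))) ≈refl))
    expandBelow-Υ (a *ᶠ x) with N , x≡ ← expandBelow-Υ x = N , λ {k} N≤k →
      let z , z∈ , x≈ = x≡ {k} N≤k
      in a *ᶠ z , scale a z∈ , ≈trans (*ᶠ-cong refl x≈) (≈trans (*ᶠ-distribˡ _ _ _)
           (+ᶠ-cong (≈sym (≈trans (expandBelow-cong k (Υ-* a x)) (expandBelow-* k a (Υ x)))) ≈refl))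
    expandBelow-Υ [ n , q ] = suc n , expandBelow-basis q

    kernel⊆relations : Kernel Υ ⊆ Relations
    kernel⊆relations {x} Υx≈0 with N , x≡ ← expandBelow-Υ x with z , z∈ , x≈ ← x≡ {N} ℕ.≤-refl = resp
      (≈sym (≈trans x≈ (≈trans (+ᶠ-cong (≈trans (expandBelow-cong N Υx≈0) (expandBelow-0 N)) ≈refl) (+ᶠ-identˡ z)))) z∈

    -- The image

    Υ-expand∈SC : ∀ {𝒜 ℬ 𝒞 : List (Subset n)} F → Partition 𝒜 ℬ 𝒞 → Υ (expand 𝒜 ℬ 𝒞 F) ∈ SC
    Υ-expand∈SC {n} {𝒜} {ℬ} {[]} F part with realised? 𝒜 ℬ
    ... | no _          = resp (λ m w → sym (Υ-0 m w)) zero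
    ... | yes (π , sep) = resp (λ m w → trans (*-congˡ (sym (Υ-Δ≈N {π = π} (𝒜≠∅ part) (ℬ≠∅ part)
        (partition-complete part) sep m w))) (sym (Υ-* _ (Δ 𝒜 ℬ) m w)))
      (scale (F n (wordOf π)) (gen (n , π , ≡.refl)))
    Υ-expand∈SC {𝒜 = 𝒜} {ℬ} {C ∷ 𝒞} F part =
      resp (λ m w → sym (Υ-+ (expand 𝒜 (C ∷ ℬ) 𝒞 F) (expand (C ∷ 𝒜) ℬ 𝒞 F) m w))
        (add (Υ-expand∈SC {𝒜 = 𝒜} {C ∷ ℬ} {𝒞} F (partition-out part))
             (Υ-expand∈SC {𝒜 = C ∷ 𝒜} {ℬ} {𝒞} F (partition-in part)))

    Υ-expandBelow∈SC : ∀ k F → Υ (expandBelow k F) ∈ SC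
    Υ-expandBelow∈SC 0       F = resp (λ m w → sym (Υ-0 m w)) zero
    Υ-expandBelow∈SC (suc n) F =
      resp (λ m w → sym (Υ-+ (expandBelow n F) (expand [] [] (nonemptySubsets n) F) m w))
      (add (Υ-expandBelow∈SC n F) (Υ-expand∈SC {𝒜 = []} {[]} F (trivialPartition n)))

    image⊆SC : Image Υ ⊆ SC
    image⊆SC (x , Υx≈F) with N , x≡ ← expandBelow-Υ x with z , z∈ , x≈ ← x≡ {N} ℕ.≤-refl = resp
      (λ m w → trans (sym (Υx≈Υy m w)) (Υx≈F m w))
      (Υ-expandBelow∈SC N (Υ x))
      where
      y = expandBelow N (Υ x)
      Υx≈Υy : Υ x ≈ˢ Υ y
      Υx≈Υy m w = trans (Υ-cong x≈ m w)
        (trans (Υ-+ y z m w) (trans (+-congˡ (relations⊆kernel z∈ m w)) (+-identityʳ _)))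

    SC⊆image : SC ⊆ Image Υ
    SC⊆image (gen (n , π , ≡.refl)) = Δ 𝒜 ℬ , Υ-Δ≈N {π = π}
      (All.filter⁺ _ (nonemptySubsets-nonempty n)) (All.filter⁺ _ (nonemptySubsets-nonempty n)) complete
      (All.all-filter (π ∈Orth?_) (nonemptySubsets n) , All.all-filter (¬? ∘ (π ∈Orth?_)) (nonemptySubsets n))
      where
      -- The preimage of `N π`: 𝒜 collects the subsets whose Orth contains π and ℬ the others, so π
      -- itself separates them.
      𝒜 = List.filter (π ∈Orth?_) (nonemptySubsets n)
      ℬ = List.filter (¬? ∘ (π ∈Orth?_)) (nonemptySubsets n)
      complete : ∀ {A} → Nonempty A → A List.∈ 𝒜 ⊎ A List.∈ ℬ
      complete {A} A≠∅ with π ∈Orth? A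
      ... | yes orth = inj₁ (List.∈-filter⁺ _ (∈-nonemptySubsets A≠∅) orth)
      ... | no ¬orth = inj₂ (List.∈-filter⁺ _ (∈-nonemptySubsets A≠∅) ¬orth)
    SC⊆image zero = 0ᶠ , Υ-0
    SC⊆image (add F∈ G∈) with x , Υx≈F ← SC⊆image F∈ | y , Υy≈G ← SC⊆image G∈ =
      x +ᶠ y , λ m w → trans (Υ-+ x y m w) (+-cong (Υx≈F m w) (Υy≈G m w))
    SC⊆image (scale a F∈) with x , Υx≈F ← SC⊆image F∈ =
      a *ᶠ x , λ m w → trans (Υ-* a x m w) (*-congˡ (Υx≈F m w))
    SC⊆image (resp F≈G F∈) with x , Υx≈F ← SC⊆image F∈ = x , λ m w → trans (Υx≈F m w) (F≈G m w)

theorem3 : ∀ {c ℓ₁ ℓ₂ r : Level} (K : HeytingField c ℓ₁ ℓ₂) → CharacteristicZero K →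
    (ℝ : RealNumbers r) →
    let open WordSymmetric K
        open HypergraphicPolytopes K ℝ
    in
    ∃ IsΥ
    × (∀ Υ → IsΥ Υ →
        Kernel Υ ≐ Span HGP (SimpleRelation ∪ ModularRelation)
        × Image Υ ≐ SC)
    × SC ⊂ WQSym
theorem3 K char0 ℝ =
  (Υ₀ , Υ₀-isΥ) ,
  (λ Υ isΥ → (kernel⊆relations isΥ , relations⊆kernel isΥ) , (image⊆SC isΥ , SC⊆image isΥ)) ,
  (SC⊆WQSym , WQSym⊈SC char0)
  where
  open Quasisymmetric K
  open Hypergraphic K ℝ
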